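{- There exists a distance-approximation algorithm for induced $P_3$-freeness whose query complexity is $\mathrm{poly}(1/\varepsilon)$.
   Context: Graphs are finite, simple and undirected; the input graph $G=(V,E)$ has $n=|V|$ vertices. The distance between two graphs $G=(V,E)$ and $G'=(V,E')$ on the same vertex set is $\Delta(G,G')=(|E\setminus E'|+|E'\setminus E|)/n^2$, and for a graph property $\mathcal{P}$ (a set of graphs), $\Delta(G,\mathcal{P})$ is the minimum of $\Delta(G,G')$ over $G'\in\mathcal{P}$ on the same vertex set. A distance-approximation algorithm for $\mathcal{P}$ is a randomized algorithm that, for every graph $G$ and every $\varepsilon\in(0,1)$, given $\varepsilon$ and query access to the adjacency matrix of $G$ (queries of the form "is $(u,v)\in E$?"), outputs an estimate $\hat\Delta$ with $|\hat\Delta-\Delta(G,\mathcal{P})|\le\varepsilon$ with probability at least $2/3$; its query complexity is the number of such queries (here bounded as a function of $\varepsilon$ only). $P_3$ is the path on $3$ vertices; a graph is induced $P_3$-free if no induced subgraph of it is isomorphic to $P_3$. -}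

module Defs where

open import Data.Nat as ℕ using (ℕ; zero; suc; _⊔_)
open import Data.Integer using (+_)
open import Data.Rational as ℚ using (ℚ; _/_; 0ℚ; 1ℚ; ½; _≤ᵇ_; ∣_∣)
open import Data.Bool using (Bool; true; false; if_then_else_)
open import Data.Fin using (Fin; toℕ)
open import Data.List using (List; map; allFin)
open import Data.Nat.ListAction using (sum)
open import Data.Product using (Σ; _×_; _,_)
open import Relation.Binary.PropositionalEquality using (_≡_; _≢_)
open import Relation.Nullary using (does)
open import Data.Bool.Properties using () renaming (_≟_ to _≟B_)

ℕ→ℚ : ℕ → ℚ
ℕ→ℚ k = + k / 1

_^ℚ_ : ℚ → ℕ → ℚ
q ^ℚ zero = 1ℚ
q ^ℚ suc k = q ℚ.* (q ^ℚ k)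

AdjMatrix : ℕ → Set
AdjMatrix n = Fin n → Fin n → Bool

IsSimpleGraph : {n : ℕ} → AdjMatrix n → Set
IsSimpleGraph {n} G = (∀ u v → G u v ≡ G v u) × (∀ u → G u u ≡ false)

InducedP3Free : {n : ℕ} → AdjMatrix n → Set
InducedP3Free G = ∀ u v w → u ≢ v → v ≢ w → u ≢ w →
  G u v ≡ true → G v w ≡ true → G u w ≡ true

diffCount : {n : ℕ} → AdjMatrix n → AdjMatrix n → ℕ
diffCount {n} G G' =
  sum (map (λ u → sum (map (λ v →
    if does (toℕ u ℕ.<? toℕ v)
    then (if does (G u v ≟B G' u v) then 0 else 1)
    else 0) (allFin n))) (allFin n))

-- d = n² · Δ(G, induced-P3-free): d is the minimum of diffCount G G'
-- over simple induced-P3-free graphs G' on the same vertex set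
IsDistP3Free : {n : ℕ} → AdjMatrix n → ℕ → Set
IsDistP3Free {n} G d =
  Σ (AdjMatrix n) (λ G' → IsSimpleGraph G' × InducedP3Free G' × diffCount G G' ≡ d)
  × (∀ (G' : AdjMatrix n) → IsSimpleGraph G' → InducedP3Free G' → d ℕ.≤ diffCount G G')

-- Randomized adaptive query algorithms on n-vertex graphs, as finite
-- decision trees: a node either flips a fair coin, or queries an entry
-- of the adjacency matrix, or halts with a rational output.

data QTree (n : ℕ) : Set where
  output : ℚ → QTree n
  coin   : (Bool → QTree n) → QTree n
  query  : Fin n → Fin n → (Bool → QTree n) → QTree n

queries : {n : ℕ} → QTree n → ℕ
queries (output _)  = 0
queries (coin k)    = queries (k true) ⊔ queries (k false)
queries (query u v k) = suc (queries (k true) ⊔ queries (k false))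

successProb : {n : ℕ} → QTree n → AdjMatrix n → (ℚ → Bool) → ℚ
successProb (output x) G good = if good x then 1ℚ else 0ℚ
successProb (coin k) G good =
  ½ ℚ.* (successProb (k true) G good ℚ.+ successProb (k false) G good)
successProb (query u v k) G good = successProb (k (G u v)) G good

-- an estimate x is ε-accurate for Δ = d / n², written without division:
-- |x·n² − d| ≤ ε·n²
accurate : ℕ → ℕ → ℚ → ℚ → Bool
accurate n d ε x = ∣ x ℚ.* ℕ→ℚ (n ℕ.* n) ℚ.- ℕ→ℚ d ∣ ≤ᵇ ε ℚ.* ℕ→ℚ (n ℕ.* n)

Algorithm : Set
Algorithm = (n : ℕ) → ℚ → QTree n

IsDistApproxP3Free : Algorithm → Set
IsDistApproxP3Free A =
  ∀ (n : ℕ) (G : AdjMatrix n) → IsSimpleGraph G →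
  ∀ (d : ℕ) → IsDistP3Free G d →
  ∀ (ε : ℚ) → 0ℚ ℚ.< ε → ε ℚ.< 1ℚ →
  (+ 2 / 3) ℚ.≤ successProb (A n ε) G (accurate n d ε)

-- query complexity poly(1/ε): queries ≤ c · (1/ε)^k, i.e. queries · ε^k ≤ c
PolyQueryComplexity : Algorithm → Set
PolyQueryComplexity A =
  Σ ℕ (λ c → Σ ℕ (λ k → ∀ (n : ℕ) (ε : ℚ) → 0ℚ ℚ.< ε → ε ℚ.< 1ℚ →
    ℕ→ℚ (queries (A n ε)) ℚ.* (ε ^ℚ k) ℚ.≤ ℕ→ℚ c))

{-# OPTIONS --safe #-}

-- Keeping the clusters of O(1/ε) random representatives and splitting the others into singletons costs O(ε), so
-- O(1/ε) vertex labels, one of which stands for singletons, suffice, and the loss is a dense binary constraint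
-- problem.
-- As in the partition algorithms of Goldreich, Goldwasser and Ron, the vertices are cut into blocks, and the
-- blocks are relabelled one after the other: each vertex greedily minimises its loss against a fresh random
-- sample carrying the current labels. Sampling errors and pairs inside a block cost O(ε) in expectation, so some
-- labelling of the samples induces a nearly optimal labelling of all vertices. Every labelling of the samples
-- induces a genuine cluster graph, hence none has loss below the distance, and the algorithm outputs the
-- smallest estimated loss among them, estimated on further random pairs.
-- Vertices are drawn with many fair coins; this gives an expectation that is close to, but in general not,
-- the uniform one, and all sampling arguments are carried out for an arbitrary expectation.

module Submission where

open import Defs
open import Data.Bool using (Bool; true; false; if_then_else_; T)
open import Data.Bool.Properties using () renaming (_≟_ to _≟B_)
open import Data.Empty using (⊥-elim)
open import Data.Fin using (Fin; zero; suc; toℕ)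
import Data.Fin.Properties as FinP
open import Data.Integer as ℤ using () renaming (+_ to pos)
import Data.Integer.Properties as ℤP
import Data.List as List
open import Data.Nat as ℕ using (ℕ; zero; suc)
open import Data.Nat.Coprimality using (Coprime)
import Data.Nat.DivMod as DivMod
open import Data.Nat.ListAction using (sum)
import Data.Nat.Properties as ℕP
open import Data.Product using (Σ; ∃; _×_; _,_; proj₁; proj₂)
import Data.Rational as ℚ
open import Data.Rational using (ℚ; mkℚ; 0ℚ; 1ℚ; ½; _+_; _*_; -_; _-_; _≤_; _<_; _/_; _⊓_; _⊔_; ∣_∣; _≤ᵇ_)
import Data.Rational.Properties as ℚP
import Data.Rational.Unnormalised as ℚᵘ
import Data.Rational.Unnormalised.Properties as ℚᵘP
open import Data.Sum using (_⊎_; inj₁; inj₂)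
open import Data.Unit using (tt)
open import Data.Vec as Vec using (Vec; []; _∷_)
open import Data.Vec.Membership.Propositional using (_∈_)
import Data.Vec.Membership.Propositional.Properties as VecM
import Data.Vec.Properties as VecP
open import Data.Vec.Relation.Unary.Any using (here; there)
open import Function using (_∘_; id)
open import Relation.Binary.PropositionalEquality using (_≡_; _≢_; refl; sym; trans; cong; cong₂; subst; subst₂)
open import Relation.Nullary using (yes; no; does)
open import Relation.Nullary.Decidable using (dec⇒maybe)
open import Tactic.RingSolver using (solve-∀)
open import Tactic.RingSolver.Core.AlmostCommutativeRing using (AlmostCommutativeRing; fromCommutativeRing)

-- Two obstacles shape the argument. A greedy choice looks at one vertex at a time, yet a whole
-- block moves simultaneously. The interaction is a second difference of the loss, which lives on
-- pairs inside the block, and such a pair is charged in a single round. Many blocks make this cost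
-- small, but the sampling error is paid in every round, so with `w` rounds it has to be of order
-- `1/w^2` each. Moreover, the number of hypotheses is exponential in `t * w`, while only second
-- moments are controlled. The amplification uses `r = t * w` independent batches, as many as a
-- hypothesis has labels, so that the number of hypotheses and the probability of an underestimate
-- are powers with the same exponent. No events or conditional probabilities occur. Every failure is
-- dominated by a nonnegative function that is at least 1 where it happens (Markov and Chebyshev,
-- pointwise), and AM-GM replaces square roots. Linearity, monotonicity and exchange of expectations
-- then suffice.

-- Inequalities and embedded naturals in the rationals

ℚ-ring : AlmostCommutativeRing _ _
ℚ-ring = fromCommutativeRing ℚP.+-*-commutativeRing (λ x → dec⇒maybe (0ℚ ℚP.≟ x))

-- The standard form of an inequality below: a nonnegative remainder is exhibited, and the identity
-- that remains is left to the ring solver.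
≤-by : ∀ {a b} r → 0ℚ ≤ r → b ≡ a + r → a ≤ b
≤-by {a} {b} r 0≤r b≡a+r =
  subst (a ≤_) (sym b≡a+r) (subst (_≤ a + r) (ℚP.+-identityʳ a) (ℚP.+-monoʳ-≤ a 0≤r))

private
  sub-add : ∀ a b → b ≡ a + (b - a)
  sub-add = solve-∀ ℚ-ring

  cancel-sub : ∀ a → a - a ≡ 0ℚ
  cancel-sub = solve-∀ ℚ-ring

≤⇒0≤- : ∀ {a b} → a ≤ b → 0ℚ ≤ b - a
≤⇒0≤- {a} {b} a≤b = subst (_≤ b - a) (cancel-sub a) (ℚP.+-monoˡ-≤ (- a) a≤b)

0≤-⇒≤ : ∀ {a b} → 0ℚ ≤ b - a → a ≤ b
0≤-⇒≤ {a} {b} p = ≤-by (b - a) p (sub-add a b)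

0≤-+ : ∀ {a b} → 0ℚ ≤ a → 0ℚ ≤ b → 0ℚ ≤ a + b
0≤-+ p q = ℚP.+-mono-≤ p q

*-monoˡ : ∀ {a b} c → 0ℚ ≤ c → a ≤ b → c * a ≤ c * b
*-monoˡ c p q = ℚP.*-monoˡ-≤-nonNeg c {{ℚ.nonNegative p}} q

*-monoʳ : ∀ {a b} c → 0ℚ ≤ c → a ≤ b → a * c ≤ b * c
*-monoʳ c p q = ℚP.*-monoʳ-≤-nonNeg c {{ℚ.nonNegative p}} q

0≤-* : ∀ {a b} → 0ℚ ≤ a → 0ℚ ≤ b → 0ℚ ≤ a * b
0≤-* {a} {b} p q = subst (_≤ a * b) (ℚP.*-zeroʳ a) (*-monoˡ a p q)

*-mono : ∀ {a b c d} → 0ℚ ≤ a → 0ℚ ≤ d → a ≤ b → c ≤ d → a * c ≤ b * d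
*-mono {a} {d = d} 0≤a 0≤d a≤b c≤d = ℚP.≤-trans (*-monoˡ a 0≤a c≤d) (*-monoʳ d 0≤d a≤b)

private
  neg-sq : ∀ a → a * a ≡ (- a) * (- a)
  neg-sq = solve-∀ ℚ-ring

0≤-sq : ∀ a → 0ℚ ≤ a * a
0≤-sq a with ℚP.≤-total 0ℚ a
... | inj₁ p = 0≤-* p p
... | inj₂ p = subst (0ℚ ≤_) (sym (neg-sq a)) (0≤-* (ℚP.neg-antimono-≤ p) (ℚP.neg-antimono-≤ p))

0≤1 : 0ℚ ≤ 1ℚ
0≤1 = ℚP.≤ᵇ⇒≤ tt

0≤½ : 0ℚ ≤ ½
0≤½ = ℚP.≤ᵇ⇒≤ tt

private
  sq-gap : ∀ x → 1ℚ ≡ x * x + ((1ℚ - x) * (1ℚ + x))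
  sq-gap = solve-∀ ℚ-ring

  rearrange-≥-1 : ∀ a b → 1ℚ + (a - b) ≡ a + (1ℚ - b)
  rearrange-≥-1 = solve-∀ ℚ-ring

  rearrange-≤-1 : ∀ a b → 1ℚ - (a - b) ≡ (1ℚ - a) + b
  rearrange-≤-1 = solve-∀ ℚ-ring

sq-diff≤1 : ∀ {a b} → 0ℚ ≤ a → a ≤ 1ℚ → 0ℚ ≤ b → b ≤ 1ℚ → (a - b) * (a - b) ≤ 1ℚ
sq-diff≤1 {a} {b} 0≤a a≤1 0≤b b≤1 = ≤-by _
  (0≤-* (subst (0ℚ ≤_) (sym (rearrange-≤-1 a b)) (0≤-+ (≤⇒0≤- a≤1) 0≤b))
        (subst (0ℚ ≤_) (sym (rearrange-≥-1 a b)) (0≤-+ 0≤a (≤⇒0≤- b≤1))))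
  (sq-gap (a - b))

ℕ→ℚ-suc : ∀ k → ℕ→ℚ (suc k) ≡ 1ℚ + ℕ→ℚ k
ℕ→ℚ-suc k = ℚP.toℚᵘ-injective (begin
  ℚ.toℚᵘ (ℕ→ℚ (suc k))                       ≈⟨ ℚP.toℚᵘ-fromℚᵘ (ℚᵘ.mkℚᵘ (pos (suc k)) 0) ⟩
  ℚᵘ.mkℚᵘ (pos (suc k)) 0                        ≈⟨ ℚᵘ.*≡* (cong (ℤ._* pos 1) (eq k)) ⟩
  ℚᵘ.1ℚᵘ ℚᵘ.+ ℚᵘ.mkℚᵘ (pos k) 0                ≈⟨ ℚᵘP.+-congʳ ℚᵘ.1ℚᵘ (ℚP.toℚᵘ-fromℚᵘ (ℚᵘ.mkℚᵘ (pos k) 0)) ⟨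
  ℚ.toℚᵘ 1ℚ ℚᵘ.+ ℚ.toℚᵘ (ℕ→ℚ k)              ≈⟨ ℚP.toℚᵘ-homo-+ 1ℚ (ℕ→ℚ k) ⟨
  ℚ.toℚᵘ (1ℚ + ℕ→ℚ k) ∎)
  where
  open ℚᵘP.≃-Reasoning
  eq : ∀ k → pos (suc k) ≡ (pos 1 ℤ.* pos 1) ℤ.+ (pos k ℤ.* pos 1)
  eq k = cong (ℤ._+_ (pos 1)) (sym (ℤP.*-identityʳ (pos k)))

ℕ→ℚ-+ : ∀ a b → ℕ→ℚ (a ℕ.+ b) ≡ ℕ→ℚ a + ℕ→ℚ b
ℕ→ℚ-+ zero b = sym (ℚP.+-identityˡ (ℕ→ℚ b))
ℕ→ℚ-+ (suc a) b = trans (ℕ→ℚ-suc (a ℕ.+ b)) (trans (cong (1ℚ +_) (ℕ→ℚ-+ a b))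
  (trans (sym (ℚP.+-assoc 1ℚ (ℕ→ℚ a) (ℕ→ℚ b))) (cong (_+ ℕ→ℚ b) (sym (ℕ→ℚ-suc a)))))

private
  one-plus-mul : ∀ a b → b + a * b ≡ (1ℚ + a) * b
  one-plus-mul = solve-∀ ℚ-ring

ℕ→ℚ-* : ∀ a b → ℕ→ℚ (a ℕ.* b) ≡ ℕ→ℚ a * ℕ→ℚ b
ℕ→ℚ-* zero b = sym (ℚP.*-zeroˡ (ℕ→ℚ b))
ℕ→ℚ-* (suc a) b = trans (ℕ→ℚ-+ b (a ℕ.* b)) (trans (cong (ℕ→ℚ b +_) (ℕ→ℚ-* a b))
  (trans (one-plus-mul (ℕ→ℚ a) (ℕ→ℚ b)) (cong (_* ℕ→ℚ b) (sym (ℕ→ℚ-suc a)))))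

0≤ℕ→ℚ : ∀ k → 0ℚ ≤ ℕ→ℚ k
0≤ℕ→ℚ zero = ℚP.≤-refl
0≤ℕ→ℚ (suc k) = subst (0ℚ ≤_) (sym (ℕ→ℚ-suc k)) (0≤-+ 0≤1 (0≤ℕ→ℚ k))

ℕ→ℚ-mono : ∀ {a b} → a ℕ.≤ b → ℕ→ℚ a ≤ ℕ→ℚ b
ℕ→ℚ-mono {a} {b} a≤b = ≤-by (ℕ→ℚ (b ℕ.∸ a)) (0≤ℕ→ℚ (b ℕ.∸ a))
  (trans (cong ℕ→ℚ (sym (ℕP.m+[n∸m]≡n a≤b))) (ℕ→ℚ-+ a (b ℕ.∸ a)))

recip : ℕ → ℚ
recip zero = 0ℚ
recip (suc k) = pos 1 / suc k

0≤recip : ∀ k → 0ℚ ≤ recip k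
0≤recip zero = ℚP.≤-refl
0≤recip (suc k) = ℚP.nonNegative⁻¹ (pos 1 / suc k) {{ℚP.normalize-nonNeg 1 (suc k)}}

ℕ→ℚ*recip : ∀ k .{{_ : ℕ.NonZero k}} → ℕ→ℚ k * recip k ≡ 1ℚ
ℕ→ℚ*recip (suc k) = ℚP.toℚᵘ-injective (begin
  ℚ.toℚᵘ (ℕ→ℚ (suc k) * recip (suc k))
    ≈⟨ ℚP.toℚᵘ-homo-* (ℕ→ℚ (suc k)) (recip (suc k)) ⟩
  ℚ.toℚᵘ (ℕ→ℚ (suc k)) ℚᵘ.* ℚ.toℚᵘ (recip (suc k))
    ≈⟨ ℚᵘP.*-cong (ℚP.toℚᵘ-fromℚᵘ (ℚᵘ.mkℚᵘ (pos (suc k)) 0)) (ℚP.toℚᵘ-fromℚᵘ (ℚᵘ.mkℚᵘ (pos 1) k)) ⟩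
  ℚᵘ.mkℚᵘ (pos (suc k)) 0 ℚᵘ.* ℚᵘ.mkℚᵘ (pos 1) k
    ≈⟨ ℚᵘ.*≡* (eq k) ⟩
  ℚᵘ.1ℚᵘ ∎)
  where
  open ℚᵘP.≃-Reasoning
  eq : ∀ k → (pos (suc k) ℤ.* pos 1) ℤ.* pos 1 ≡ pos 1 ℤ.* pos (1 ℕ.* suc k)
  eq k = trans (ℤP.*-identityʳ (pos (suc k) ℤ.* pos 1)) (trans (ℤP.*-identityʳ (pos (suc k)))
    (sym (trans (ℤP.*-identityˡ (pos (1 ℕ.* suc k))) (cong pos (ℕP.*-identityˡ (suc k))))))

-- Finite expectations

-- A positive normalised linear functional instead of a list of weights, so that uniform averages,
-- coin trees, products and iterated samples are all instances of one notion.
record Expectation (A : Set) : Set where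
  field
    𝔼 : (A → ℚ) → ℚ
    𝔼-mono : ∀ {f g} → (∀ a → f a ≤ g a) → 𝔼 f ≤ 𝔼 g
    𝔼-+ : ∀ f g → 𝔼 (λ a → f a + g a) ≡ 𝔼 f + 𝔼 g
    𝔼-* : ∀ c f → 𝔼 (λ a → c * f a) ≡ c * 𝔼 f
    𝔼-const : ∀ c → 𝔼 (λ _ → c) ≡ c

  𝔼-cong : ∀ {f g} → (∀ a → f a ≡ g a) → 𝔼 f ≡ 𝔼 g
  𝔼-cong f≗g = ℚP.≤-antisym (𝔼-mono (ℚP.≤-reflexive ∘ f≗g)) (𝔼-mono (ℚP.≤-reflexive ∘ sym ∘ f≗g))

  𝔼-≤ : ∀ {f c} → (∀ a → f a ≤ c) → 𝔼 f ≤ c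
  𝔼-≤ {f} {c} f≤c = subst (𝔼 f ≤_) (𝔼-const c) (𝔼-mono f≤c)

  𝔼-≥ : ∀ {f c} → (∀ a → c ≤ f a) → c ≤ 𝔼 f
  𝔼-≥ {f} {c} c≤f = subst (_≤ 𝔼 f) (𝔼-const c) (𝔼-mono c≤f)

  𝔼-*ʳ : ∀ c f → 𝔼 (λ a → f a * c) ≡ 𝔼 f * c
  𝔼-*ʳ c f = trans (𝔼-cong (λ a → ℚP.*-comm (f a) c)) (trans (𝔼-* c f) (ℚP.*-comm c (𝔼 f)))

  𝔼-neg : ∀ f → 𝔼 (λ a → - f a) ≡ - 𝔼 f
  𝔼-neg f = trans (𝔼-cong (λ a → neg≡ (f a))) (trans (𝔼-* (- 1ℚ) f) (sym (neg≡ (𝔼 f))))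
    where
    neg≡ : ∀ x → - x ≡ (- 1ℚ) * x
    neg≡ = solve-∀ ℚ-ring

  𝔼-- : ∀ f g → 𝔼 (λ a → f a - g a) ≡ 𝔼 f - 𝔼 g
  𝔼-- f g = trans (𝔼-+ f (λ a → - g a)) (cong (λ z → 𝔼 f + z) (𝔼-neg g))

  𝔼-+const : ∀ f c → 𝔼 (λ a → f a + c) ≡ 𝔼 f + c
  𝔼-+const f c = trans (𝔼-+ f (λ _ → c)) (cong (λ z → 𝔼 f + z) (𝔼-const c))

open Expectation

-- Exchange of order is a separate property, asked of the vertex law. The second expectation is
-- arbitrary because a vertex is exchanged both with another vertex and with a whole sample.
Fubini : ∀ {A} → Expectation A → Set₁
Fubini {A} P = ∀ {B} (Q : Expectation B) (f : A → B → ℚ) →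
  𝔼 P (λ a → 𝔼 Q (f a)) ≡ 𝔼 Q (λ b → 𝔼 P (λ a → f a b))

infixr 7 _⊗_

_⊗_ : ∀ {A B} → Expectation A → Expectation B → Expectation (A × B)
P ⊗ Q = record
  { 𝔼 = λ f → 𝔼 P (λ a → 𝔼 Q (λ b → f (a , b)))
  ; 𝔼-mono = λ f≤g → 𝔼-mono P (λ a → 𝔼-mono Q (λ b → f≤g (a , b)))
  ; 𝔼-+ = λ f g → trans (𝔼-cong P (λ a → 𝔼-+ Q (λ b → f (a , b)) (λ b → g (a , b)))) (𝔼-+ P _ _)
  ; 𝔼-* = λ c f → trans (𝔼-cong P (λ a → 𝔼-* Q c (λ b → f (a , b)))) (𝔼-* P c _)
  ; 𝔼-const = λ c → trans (𝔼-cong P (λ _ → 𝔼-const Q c)) (𝔼-const P c)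
  }

iid : ∀ {A} → Expectation A → (t : ℕ) → Expectation (Vec A t)
iid P zero = record
  { 𝔼 = λ f → f []
  ; 𝔼-mono = λ f≤g → f≤g []
  ; 𝔼-+ = λ _ _ → refl
  ; 𝔼-* = λ _ _ → refl
  ; 𝔼-const = λ _ → refl
  }
iid P (suc t) = record
  { 𝔼 = λ f → 𝔼 P (λ a → 𝔼 (iid P t) (λ as → f (a ∷ as)))
  ; 𝔼-mono = λ f≤g → 𝔼-mono P (λ a → 𝔼-mono (iid P t) (λ as → f≤g (a ∷ as)))
  ; 𝔼-+ = λ f g → trans (𝔼-cong P (λ a → 𝔼-+ (iid P t) (λ as → f (a ∷ as)) (λ as → g (a ∷ as)))) (𝔼-+ P _ _)
  ; 𝔼-* = λ c f → trans (𝔼-cong P (λ a → 𝔼-* (iid P t) c (λ as → f (a ∷ as)))) (𝔼-* P c _)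
  ; 𝔼-const = λ c → trans (𝔼-cong P (λ _ → 𝔼-const (iid P t) c)) (𝔼-const P c)
  }

total : ∀ {A : Set} {t} → (A → ℚ) → Vec A t → ℚ
total f [] = 0ℚ
total f (x ∷ xs) = f x + total f xs

prod : ∀ {A : Set} {t} → (A → ℚ) → Vec A t → ℚ
prod f [] = 1ℚ
prod f (x ∷ xs) = f x * prod f xs

mean : ∀ {A : Set} {t} → (A → ℚ) → Vec A t → ℚ
mean {t = t} f xs = recip t * total f xs

total-shift : ∀ {A : Set} {t} (f : A → ℚ) c (xs : Vec A t) →
  total (λ a → f a - c) xs ≡ total f xs - ℕ→ℚ t * c
total-shift f c [] = lemma c
  where
  lemma : ∀ c → 0ℚ ≡ 0ℚ - 0ℚ * c
  lemma = solve-∀ ℚ-ring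
total-shift {t = suc t} f c (x ∷ xs) = trans (cong (f x - c +_) (total-shift f c xs))
  (trans (lemma (f x) c (total f xs) (ℕ→ℚ t)) (cong (λ z → f x + total f xs - z * c) (sym (ℕ→ℚ-suc t))))
  where
  lemma : ∀ a c s t → a - c + (s - t * c) ≡ a + s - (1ℚ + t) * c
  lemma = solve-∀ ℚ-ring

module _ {A : Set} (P : Expectation A) where

  𝔼-total : ∀ f t → 𝔼 (iid P t) (total f) ≡ ℕ→ℚ t * 𝔼 P f
  𝔼-total f zero = sym (ℚP.*-zeroˡ (𝔼 P f))
  𝔼-total f (suc t) = trans
    (𝔼-cong P (λ a → trans (𝔼-+ (iid P t) (λ _ → f a) (total f)) (cong₂ _+_ (𝔼-const (iid P t) (f a)) (𝔼-total f t))))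
    (trans (𝔼-+const P f (ℕ→ℚ t * 𝔼 P f))
      (trans (lemma (𝔼 P f) (ℕ→ℚ t)) (cong (_* 𝔼 P f) (sym (ℕ→ℚ-suc t)))))
    where
    lemma : ∀ x t → x + t * x ≡ (1ℚ + t) * x
    lemma = solve-∀ ℚ-ring

  𝔼-prod : ∀ f t → 𝔼 (iid P t) (prod f) ≡ 𝔼 P f ^ℚ t
  𝔼-prod f zero = refl
  𝔼-prod f (suc t) = trans
    (𝔼-cong P (λ a → trans (𝔼-* (iid P t) (f a) (prod f)) (cong (f a *_) (𝔼-prod f t))))
    (𝔼-*ʳ P (𝔼 P f ^ℚ t) f)


  -- Variances of independent centred terms add: the cross term with a new summand contains the mean
  -- of the remaining sum, which is zero.
  𝔼-total² : ∀ g t → 𝔼 P g ≡ 0ℚ → (∀ a → g a * g a ≤ 1ℚ) →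
    𝔼 (iid P t) (λ xs → total g xs * total g xs) ≤ ℕ→ℚ t
  𝔼-total² g zero _ _ = ℚP.≤-refl
  𝔼-total² g (suc t) 𝔼g≡0 g²≤1 = subst (𝔼 (iid P (suc t)) (λ xs → total g xs * total g xs) ≤_)
    (sym (ℕ→ℚ-suc t)) (𝔼-≤ P inner)
    where
    Pᵗ = iid P t
    𝔼Z≡0 : 𝔼 Pᵗ (total g) ≡ 0ℚ
    𝔼Z≡0 = trans (𝔼-total g t) (trans (cong (ℕ→ℚ t *_) 𝔼g≡0) (ℚP.*-zeroʳ (ℕ→ℚ t)))
    expand : ∀ a z → (a + z) * (a + z) ≡ (a + a) * z + (z * z + a * a)
    expand = solve-∀ ℚ-ring
    cross : ∀ a v s → (a + a) * 0ℚ + (v + s) ≡ s + v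
    cross = solve-∀ ℚ-ring
    inner : ∀ a → 𝔼 Pᵗ (λ xs → (g a + total g xs) * (g a + total g xs)) ≤ 1ℚ + ℕ→ℚ t
    inner a = subst (_≤ 1ℚ + ℕ→ℚ t) (sym (trans (𝔼-cong Pᵗ (λ xs → expand (g a) (total g xs)))
      (trans (𝔼-+ Pᵗ (λ xs → (g a + g a) * total g xs) (λ xs → total g xs * total g xs + g a * g a))
        (trans (cong₂ _+_ (trans (𝔼-* Pᵗ (g a + g a) (total g)) (cong ((g a + g a) *_) 𝔼Z≡0))
                          (𝔼-+const Pᵗ (λ xs → total g xs * total g xs) (g a * g a)))
          (cross (g a) (𝔼 Pᵗ (λ xs → total g xs * total g xs)) (g a * g a))))))
      (ℚP.+-mono-≤ (g²≤1 a) (𝔼-total² g t 𝔼g≡0 g²≤1))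

  -- This second-moment bound is the only source of concentration; exponentially small failure is
  -- later obtained by repetition.
  mean-variance : ∀ f t .{{_ : ℕ.NonZero t}} → (∀ a → 0ℚ ≤ f a) → (∀ a → f a ≤ 1ℚ) →
    𝔼 (iid P t) (λ xs → (mean f xs - 𝔼 P f) * (mean f xs - 𝔼 P f)) ≤ recip t
  mean-variance f t 0≤f f≤1 = subst₂ _≤_ step collapse
    (*-monoˡ (recip t * recip t) (0≤-* (0≤recip t) (0≤recip t)) (𝔼-total² g t 𝔼g≡0 g²≤1))
    where
    μ = 𝔼 P f
    g : A → ℚ
    g a = f a - μ
    cancel : ∀ a → a - a ≡ 0ℚ
    cancel = solve-∀ ℚ-ring
    𝔼g≡0 : 𝔼 P g ≡ 0ℚ
    𝔼g≡0 = trans (𝔼-- P f (λ _ → μ)) (trans (cong (λ z → μ - z) (𝔼-const P μ)) (cancel μ))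
    g²≤1 : ∀ a → g a * g a ≤ 1ℚ
    g²≤1 a = sq-diff≤1 (0≤f a) (f≤1 a) (𝔼-≥ P 0≤f) (𝔼-≤ P f≤1)
    regroup : ∀ r s n m → r * s - (n * r) * m ≡ r * (s - n * m)
    regroup = solve-∀ ℚ-ring
    deviation : ∀ xs → mean f xs - μ ≡ recip t * total g xs
    deviation xs = trans (cong (λ z → mean f xs - z) (sym (ℚP.*-identityˡ μ)))
      (trans (cong (λ z → mean f xs - z * μ) (sym (ℕ→ℚ*recip t)))
      (trans (regroup (recip t) (total f xs) (ℕ→ℚ t) μ)
             (cong (recip t *_) (sym (total-shift f μ xs)))))
    square : ∀ r s → (r * s) * (r * s) ≡ (r * r) * (s * s)
    square = solve-∀ ℚ-ring
    step : (recip t * recip t) * 𝔼 (iid P t) (λ xs → total g xs * total g xs)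
         ≡ 𝔼 (iid P t) (λ xs → (mean f xs - μ) * (mean f xs - μ))
    step = trans (sym (𝔼-* (iid P t) (recip t * recip t) (λ xs → total g xs * total g xs)))
      (𝔼-cong (iid P t) (λ xs → sym (trans (cong (λ z → z * z) (deviation xs)) (square (recip t) (total g xs)))))
    regroup₂ : ∀ r n → (r * r) * n ≡ r * (n * r)
    regroup₂ = solve-∀ ℚ-ring
    collapse : (recip t * recip t) * ℕ→ℚ t ≡ recip t
    collapse = trans (regroup₂ (recip t) (ℕ→ℚ t)) (trans (cong (recip t *_) (ℕ→ℚ*recip t)) (ℚP.*-identityʳ (recip t)))

total-≥0 : ∀ {A : Set} {t} {f : A → ℚ} → (∀ a → 0ℚ ≤ f a) → (xs : Vec A t) → 0ℚ ≤ total f xs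
total-≥0 0≤f [] = ℚP.≤-refl
total-≥0 0≤f (x ∷ xs) = 0≤-+ (0≤f x) (total-≥0 0≤f xs)

∈-≤-total : ∀ {A : Set} {t} {f : A → ℚ} → (∀ a → 0ℚ ≤ f a) → {xs : Vec A t} {x : A} → x ∈ xs → f x ≤ total f xs
∈-≤-total 0≤f {_ ∷ xs} (here refl) = ≤-by _ (total-≥0 0≤f xs) refl
∈-≤-total {f = f} 0≤f {y ∷ xs} (there x∈) =
  ℚP.≤-trans (∈-≤-total 0≤f x∈) (≤-by _ (0≤f y) (ℚP.+-comm (f y) (total f xs)))

𝔼-total-≤ : ∀ {A C : Set} {t} (P : Expectation A) (f : C → A → ℚ) {B} → (∀ c → 𝔼 P (f c) ≤ B) →
  (cs : Vec C t) → 𝔼 P (λ a → total (λ c → f c a) cs) ≤ ℕ→ℚ t * B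
𝔼-total-≤ P f {B} 𝔼f≤B [] = ℚP.≤-reflexive (trans (𝔼-const P 0ℚ) (sym (ℚP.*-zeroˡ B)))
𝔼-total-≤ {t = suc t} P f {B} 𝔼f≤B (c ∷ cs) = ℚP.≤-trans
  (ℚP.≤-reflexive (𝔼-+ P (f c) (λ a → total (λ c → f c a) cs)))
  (ℚP.≤-trans (ℚP.+-mono-≤ (𝔼f≤B c) (𝔼-total-≤ P f 𝔼f≤B cs))
    (ℚP.≤-reflexive (trans (lemma B (ℕ→ℚ t)) (cong (_* B) (sym (ℕ→ℚ-suc t))))))
  where
  lemma : ∀ b t → b + t * b ≡ (1ℚ + t) * b
  lemma = solve-∀ ℚ-ring

≡ᵇ-true : ∀ a b → (a ℕ.≡ᵇ b) ≡ true → a ≡ b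
≡ᵇ-true a b e = ℕP.≡ᵇ⇒≡ a b (subst T (sym e) tt)

≡ᵇ-refl : ∀ a → (a ℕ.≡ᵇ a) ≡ true
≡ᵇ-refl zero = refl
≡ᵇ-refl (suc a) = ≡ᵇ-refl a

≡ᵇ-false : ∀ a b → (a ℕ.≡ᵇ b) ≡ false → a ≢ b
≡ᵇ-false a _ e refl = subst T e (ℕP.≡⇒≡ᵇ a a refl)

2ℚ : ℚ
2ℚ = 1ℚ + 1ℚ

0≤2 : 0ℚ ≤ 2ℚ
0≤2 = ℚP.≤ᵇ⇒≤ tt

halve-≤ : ∀ {a b} → a + a ≤ b + b → a ≤ b
halve-≤ {a} {b} p = subst₂ _≤_ (half a) (half b) (*-monoˡ ½ 0≤½ p)
  where
  half : ∀ a → ½ * (a + a) ≡ a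
  half = solve-∀ ℚ-ring

-- Expansion of `M * (e - η)^2 ≥ 0`. It turns a linear error into a squared one, whose expectation
-- is a variance, without absolute values or square roots.
am-gm : ∀ {M η} → 0ℚ ≤ M → M * η ≡ 1ℚ → ∀ e → e + e ≤ η + M * (e * e)
am-gm {M} {η} 0≤M Mη≡1 e = ≤-by _ (0≤-* 0≤M (0≤-sq (e - η)))
  (trans (cong (_+ M * (e * e)) (sym (ℚP.*-identityʳ η))) (trans (cong (λ z → η * z + M * (e * e)) (sym Mη≡1))
    (trans (lemma M η e) (cong (λ z → z + M * ((e - η) * (e - η)))
      (trans (cong ((e + e) *_) Mη≡1) (ℚP.*-identityʳ (e + e)))))))
  where
  lemma : ∀ M η e → η * (M * η) + M * (e * e) ≡ (e + e) * (M * η) + M * ((e - η) * (e - η))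
  lemma = solve-∀ ℚ-ring

-- Blockwise greedy relabelling

module Rounds {A : Set} (W : Expectation A) (fubini : Fubini W) (k : ℕ)
  (φ : A → A → Fin (suc k) → Fin (suc k) → ℚ) (p : A → A → ℚ)
  (φ≥0 : ∀ u v i j → 0ℚ ≤ φ u v i j) (φ≤p : ∀ u v i j → φ u v i j ≤ p u v)
  (bl : A → ℕ) (t : ℕ) {{_ : ℕ.NonZero t}}
  (pick : Vec A t → Vec (Fin (suc k)) t → A → Fin (suc k))
  where

  Lab : Set
  Lab = Fin (suc k)

  σ : A → A → Lab → Lab → ℚ
  σ u v i j = φ u v i j + φ v u j i

  cost : (A → Lab) → ℚ
  cost x = 𝔼 W (λ u → 𝔼 W (λ v → φ u v (x u) (x v)))

  -- The first-order part of `cost` in the label of `v`. Both terms of `σ` are present because `v`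
  -- occurs as first and as second endpoint of a pair.
  score : (A → Lab) → A → Lab → ℚ
  score x v c = 𝔼 W (λ u → σ u v (x u) c)

  update : ℕ → (A → Lab) → Vec A t → A → Lab
  update b x S v = if bl v ℕ.≡ᵇ b then pick S (Vec.map x S) v else x v

  run : ∀ {m} → ℕ → (A → Lab) → Vec (Vec A t) m → A → Lab
  run b x [] = x
  run b x (S ∷ Ss) = run (suc b) (update b x S) Ss

  -- The label of one vertex, computed from the samples and their labels alone. This locality is
  -- what allows the final labelling to be evaluated by queries.
  label : ∀ {m} → ℕ → Lab → A → Vec (Vec Lab t) m → Vec (Vec A t) m → Lab
  label b c v [] [] = c
  label b c v (ℓ ∷ ℓs) (S ∷ Ss) = label (suc b) (if bl v ℕ.≡ᵇ b then pick S ℓ v else c) v ℓs Ss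

  -- Each sample keeps the labels current at the time it is drawn, before its own round changes
  -- them. These are the labels that the algorithm has to guess.
  sampleLabels : ∀ {m} → ℕ → (A → Lab) → Vec (Vec A t) m → Vec (Vec Lab t) m
  sampleLabels b x [] = []
  sampleLabels b x (S ∷ Ss) = Vec.map x S ∷ sampleLabels (suc b) (update b x S) Ss

  run≡label : ∀ {m} b x (Ss : Vec (Vec A t) m) v → run b x Ss v ≡ label b (x v) v (sampleLabels b x Ss) Ss
  run≡label b x [] v = refl
  run≡label b x (S ∷ Ss) v = run≡label (suc b) (update b x S) Ss v

  -- The round of the block of `v` overwrites whatever label `v` had. Hence the starting labelling,
  -- which only the analysis knows, leaves no trace once the rounds cover all blocks.
  label-start : ∀ {m} b c c′ v (ℓs : Vec (Vec Lab t) m) Ss → b ℕ.≤ bl v → bl v ℕ.< b ℕ.+ m →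
    label b c v ℓs Ss ≡ label b c′ v ℓs Ss
  label-start b c c′ v [] [] b≤ <b = ⊥-elim (ℕP.<⇒≱ <b (subst (ℕ._≤ bl v) (sym (ℕP.+-identityʳ b)) b≤))
  label-start {suc m} b c c′ v (ℓ ∷ ℓs) (S ∷ Ss) b≤ <b with bl v ℕ.≡ᵇ b in e
  ... | true = refl
  ... | false = label-start (suc b) c c′ v ℓs Ss (ℕP.≤∧≢⇒< b≤ (≡ᵇ-false (bl v) b e ∘ sym))
                    (subst (bl v ℕ.<_) (ℕP.+-suc b m) <b)

  sameBlock : A → A → ℚ
  sameBlock u v = if bl u ℕ.≡ᵇ bl v then 1ℚ else 0ℚ

  hit : ℕ → A → A → ℚ
  hit b u v = if bl u ℕ.≡ᵇ b then sameBlock u v else 0ℚ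

  hits : ℕ → ℕ → A → A → ℚ
  hits b zero u v = 0ℚ
  hits b (suc m) u v = hit b u v + hits (suc b) m u v

  sameBlock-≥0 : ∀ u v → 0ℚ ≤ sameBlock u v
  sameBlock-≥0 u v with bl u ℕ.≡ᵇ bl v
  ... | true = 0≤1
  ... | false = ℚP.≤-refl

  hits-past : ∀ b m u v → bl u ℕ.< b → hits b m u v ≡ 0ℚ
  hits-past b zero u v _ = refl
  hits-past b (suc m) u v <b with bl u ℕ.≡ᵇ b in e
  ... | true = ⊥-elim (ℕP.<-irrefl (≡ᵇ-true (bl u) b e) <b)
  ... | false = trans (ℚP.+-identityˡ _) (hits-past (suc b) m u v (ℕP.m<n⇒m<1+n <b))

  -- A vertex belongs to one block, so at most one summand is nonzero: the second-order cost of all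
  -- rounds together is paid for one partition, not once per round.
  hits-≤ : ∀ b m u v → hits b m u v ≤ sameBlock u v
  hits-≤ b zero u v = sameBlock-≥0 u v
  hits-≤ b (suc m) u v with bl u ℕ.≡ᵇ b in e
  ... | false = subst (_≤ sameBlock u v) (sym (ℚP.+-identityˡ _)) (hits-≤ (suc b) m u v)
  ... | true = ℚP.≤-reflexive (trans
                   (cong (sameBlock u v +_) (hits-past (suc b) m u v (ℕ.s≤s (ℕP.≤-reflexive (≡ᵇ-true (bl u) b e)))))
                                         (ℚP.+-identityʳ _))

  pairs : (A → A → ℚ) → ℚ
  pairs f = 𝔼 W (λ u → 𝔼 W (f u))

  pairs-mono : ∀ {f g} → (∀ u v → f u v ≤ g u v) → pairs f ≤ pairs g
  pairs-mono f≤g = 𝔼-mono W (λ u → 𝔼-mono W (f≤g u))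

  pairs-+ : ∀ f g → pairs (λ u v → f u v + g u v) ≡ pairs f + pairs g
  pairs-+ f g = 𝔼-+ (W ⊗ W) (λ (u , v) → f u v) (λ (u , v) → g u v)

  pairs-* : ∀ c f → pairs (λ u v → c * f u v) ≡ c * pairs f
  pairs-* c f = 𝔼-* (W ⊗ W) c (λ (u , v) → f u v)

  module _ (x : A → Lab) (b : ℕ) (S : Vec A t) where
    private
      y = update b x S

    -- The second difference of φ vanishes unless both endpoints lie in block b.
    change-≤ : ∀ u v → φ u v (y u) (y v) ≤
      φ u v (x u) (x v) + ((φ u v (x u) (y v) - φ u v (x u) (x v)) + (φ u v (y u) (x v) - φ u v (x u) (x v)))
        + 2ℚ * (p u v * hit b u v)
    change-≤ u v with bl u ℕ.≡ᵇ b in eu | bl v ℕ.≡ᵇ b in ev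
    ... | false | _ = ℚP.≤-reflexive (lemma (φ u v (x u) (x v)) (φ u v (x u) _) (p u v))
      where
      lemma : ∀ a c p → c ≡ a + ((c - a) + (a - a)) + 2ℚ * (p * 0ℚ)
      lemma = solve-∀ ℚ-ring
    ... | true | false with bl u ℕ.≡ᵇ bl v in e
    ...   | true = ⊥-elim (≡ᵇ-false (bl v) b ev (trans (sym (≡ᵇ-true (bl u) (bl v) e)) (≡ᵇ-true (bl u) b eu)))
    ...   | false = ℚP.≤-reflexive (lemma (φ u v (x u) (x v)) (φ u v _ (x v)) (p u v))
      where
      lemma : ∀ a c p → c ≡ a + ((a - a) + (c - a)) + 2ℚ * (p * 0ℚ)
      lemma = solve-∀ ℚ-ring
    change-≤ u v | true | true with bl u ℕ.≡ᵇ bl v in e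
    ...   | false = ⊥-elim (≡ᵇ-false (bl u) (bl v) e (trans (≡ᵇ-true (bl u) b eu) (sym (≡ᵇ-true (bl v) b ev))))
    -- Both endpoints move. The second difference is at most twice `p`, since the two mixed losses
    -- are nonnegative and the old and new losses are at most `p`.
    ...   | true = ≤-by _
      (0≤-+ (0≤-+ (φ≥0 u v (x u) Y) (φ≥0 u v X (x v)))
            (0≤-+ (≤⇒0≤- (φ≤p u v (x u) (x v))) (≤⇒0≤- (φ≤p u v X Y))))
      (lemma (φ u v (x u) (x v)) (φ u v (x u) Y) (φ u v X (x v)) (φ u v X Y) (p u v))
      where
      X = pick S (Vec.map x S) u
      Y = pick S (Vec.map x S) v
      lemma : ∀ a b c d p → a + ((b - a) + (c - a)) + 2ℚ * (p * 1ℚ) ≡ d + ((b + c) + ((p - a) + (p - d)))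
      lemma = solve-∀ ℚ-ring

    cost-update-≤ : cost y ≤ cost x + 𝔼 W (λ v → score x v (y v) - score x v (x v))
      + 2ℚ * pairs (λ u v → p u v * hit b u v)
    cost-update-≤ = ℚP.≤-trans (pairs-mono change-≤) (ℚP.≤-reflexive
      (trans (pairs-+ (λ u v → base u v + (d₁ u v + d₂ u v)) (λ u v → 2ℚ * (p u v * hit b u v)))
        (cong₂ _+_
          (trans (pairs-+ base (λ u v → d₁ u v + d₂ u v)) (cong (cost x +_) drift))
          (pairs-* 2ℚ (λ u v → p u v * hit b u v)))))
      where
      base d₁ d₂ : A → A → ℚ
      base u v = φ u v (x u) (x v)
      d₁ u v = φ u v (x u) (y v) - φ u v (x u) (x v)
      d₂ u v = φ u v (y u) (x v) - φ u v (x u) (x v)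
      lemma : ∀ a b c d → (a - b) + (c - d) ≡ (a + c) - (b + d)
      lemma = solve-∀ ℚ-ring
      -- `d₁` moves the second endpoint and `d₂` the first. Exchanging the order in `d₁` makes the
      -- moving vertex the outer variable of both, and the two losses combine to `σ`.
      drift : pairs (λ u v → d₁ u v + d₂ u v) ≡ 𝔼 W (λ v → score x v (y v) - score x v (x v))
      drift = trans (pairs-+ d₁ d₂) (trans (cong (_+ pairs d₂) (fubini W d₁))
        (trans (sym (pairs-+ (λ v u → d₁ u v) d₂))
          (𝔼-cong W (λ v → trans
            (𝔼-cong W (λ u → lemma (φ u v (x u) (y v)) (φ u v (x u) (x v)) (φ v u (y v) (x u)) (φ v u (x v) (x u))))
            (𝔼-- W (λ u → σ u v (x u) (y v)) (λ u → σ u v (x u) (x v)))))))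

  module Analysis
    (σ≤1 : ∀ u v i j → σ u v i j ≤ 1ℚ)
    (pick-min : ∀ S x v c → total (λ s → σ s v (x s) (pick S (Vec.map x S) v)) S ≤ total (λ s → σ s v (x s) c) S)
    (η M : ℚ) (0≤η : 0ℚ ≤ η) (0≤M : 0ℚ ≤ M) (Mη≡1 : M * η ≡ 1ℚ)
    where

    σ≥0 : ∀ u v i j → 0ℚ ≤ σ u v i j
    σ≥0 u v i j = 0≤-+ (φ≥0 u v i j) (φ≥0 v u j i)

    module _ (x : A → Lab) (v : A) where

      err : Lab → Vec A t → ℚ
      err c S = mean (λ s → σ s v (x s) c) S - score x v c

      err² : Lab → Vec A t → ℚ
      err² c S = err c S * err c S

      -- The picked label depends on the sample, so its error has no usable mean of its own. Summing
      -- the squared errors over all labels gives a bound that does not refer to the choice.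
      noise : Vec A t → ℚ
      noise S = η + M * total (λ c → err² c S) (Vec.allFin (suc k))

      err²-≤ : ∀ c S → err² c S ≤ total (λ c → err² c S) (Vec.allFin (suc k))
      err²-≤ c S = ∈-≤-total (λ c → 0≤-sq (err c S)) (VecM.∈-allFin⁺ c)

      noise-≥0 : ∀ S → 0ℚ ≤ noise S
      noise-≥0 S = 0≤-+ 0≤η (0≤-* 0≤M (total-≥0 (λ c → 0≤-sq (err c S)) (Vec.allFin (suc k))))

      -- On the sample the picked label is at least as good as the old one, so the true scores can
      -- differ in the wrong direction only by the two sampling errors, each absorbed by `am-gm`.
      pick-≤ : ∀ S → score x v (pick S (Vec.map x S) v) - score x v (x v) ≤ noise S
      pick-≤ S = halve-≤ (ℚP.≤-trans (≤-by _ (0≤-+ (≤⇒0≤- best) (≤⇒0≤- best))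
          (regroup (mean (λ s → σ s v (x s) c) S) (mean (λ s → σ s v (x s) o) S) (score x v c) (score x v o)))
        (ℚP.≤-trans (ℚP.+-mono-≤ (am-gm 0≤M Mη≡1 (err o S)) (am-gm 0≤M Mη≡1 (- err c S)))
          (≤-by _ (0≤-* 0≤M (0≤-+ (≤⇒0≤- (err²-≤ o S)) (≤⇒0≤- (err²-≤ c S))))
            (collect η M E (err o S) (err c S)))))
        where
        c o : Lab
        c = pick S (Vec.map x S) v
        o = x v
        E : ℚ
        E = total (λ c → err² c S) (Vec.allFin (suc k))
        best : mean (λ s → σ s v (x s) c) S ≤ mean (λ s → σ s v (x s) o) S
        best = *-monoˡ (recip t) (0≤recip t) (pick-min S x v o)
        regroup : ∀ mc mo sc so → ((mo - so) + (mo - so)) + (- (mc - sc) + - (mc - sc)) ≡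
          ((sc - so) + (sc - so)) + ((mo - mc) + (mo - mc))
        regroup = solve-∀ ℚ-ring
        collect : ∀ η M E eo ec → (η + M * E) + (η + M * E) ≡
          ((η + M * (eo * eo)) + (η + M * ((- ec) * (- ec)))) + M * ((E - eo * eo) + (E - ec * ec))
        collect = solve-∀ ℚ-ring

      𝔼-noise : 𝔼 (iid W t) noise ≤ η + M * (ℕ→ℚ (suc k) * recip t)
      𝔼-noise = subst (_≤ η + M * (ℕ→ℚ (suc k) * recip t))
        (sym (trans (𝔼-+ (iid W t) (λ _ → η) (λ S → M * total (λ c → err² c S) (Vec.allFin (suc k))))
          (cong₂ _+_ (𝔼-const (iid W t) η) (𝔼-* (iid W t) M (λ S → total (λ c → err² c S) (Vec.allFin (suc k)))))))
        (ℚP.+-monoʳ-≤ η (*-monoˡ M 0≤M (𝔼-total-≤ (iid W t) err²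
          (λ c → mean-variance W (λ s → σ s v (x s) c) t (λ s → σ≥0 s v (x s) c) (λ s → σ≤1 s v (x s) c))
          (Vec.allFin (suc k)))))

    ρ : ℚ
    ρ = η + M * (ℕ→ℚ (suc k) * recip t)

    gain-≤ : ∀ x b S v → score x v (update b x S v) - score x v (x v) ≤ noise x v S
    gain-≤ x b S v with bl v ℕ.≡ᵇ b
    ... | true = pick-≤ x v S
    ... | false = subst (_≤ noise x v S) (sym (ℚP.+-inverseʳ (score x v (x v)))) (noise-≥0 x v S)

    -- Freshness of the sample enters here: `x` is fixed before `S` is drawn, so the noise can be
    -- averaged for each vertex separately after an exchange of expectations.
    round-≤ : ∀ b x → 𝔼 (iid W t) (λ S → cost (update b x S)) ≤ cost x + ρ + 2ℚ * pairs (λ u v → p u v * hit b u v)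
    round-≤ b x = ℚP.≤-trans
      (𝔼-mono Wᵗ (λ S → ℚP.≤-trans (cost-update-≤ x b S)
        (ℚP.+-monoˡ-≤ H (ℚP.+-monoʳ-≤ (cost x) (𝔼-mono W (gain-≤ x b S))))))
      (ℚP.≤-trans (ℚP.≤-reflexive (trans (𝔼-+const Wᵗ (λ S → cost x + 𝔼 W (λ v → noise x v S)) H)
          (cong (_+ H) (trans (𝔼-+ Wᵗ (λ _ → cost x) (λ S → 𝔼 W (λ v → noise x v S)))
            (cong₂ _+_ (𝔼-const Wᵗ (cost x)) (sym (fubini Wᵗ (noise x))))))))
        (ℚP.+-monoˡ-≤ H (ℚP.+-monoʳ-≤ (cost x) (𝔼-≤ W (𝔼-noise x)))))
      where
      Wᵗ = iid W t
      H = 2ℚ * pairs (λ u v → p u v * hit b u v)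

    run-≤-hits : ∀ m b x → 𝔼 (iid (iid W t) m) (λ Ss → cost (run b x Ss)) ≤
      cost x + ℕ→ℚ m * ρ + 2ℚ * pairs (λ u v → p u v * hits b m u v)
    run-≤-hits zero b x = ℚP.≤-reflexive (trans (lemma (cost x) ρ)
      (cong (λ z → cost x + 0ℚ * ρ + 2ℚ * z) (sym (trans (pairs-mono-≡ (λ u v → ℚP.*-zeroʳ (p u v)))
        (trans (𝔼-cong W (λ _ → 𝔼-const W 0ℚ)) (𝔼-const W 0ℚ))))))
      where
      pairs-mono-≡ : ∀ {f g} → (∀ u v → f u v ≡ g u v) → pairs f ≡ pairs g
      pairs-mono-≡ f≗g = 𝔼-cong W (λ u → 𝔼-cong W (f≗g u))
      lemma : ∀ c r → c ≡ c + 0ℚ * r + 2ℚ * 0ℚ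
      lemma = solve-∀ ℚ-ring
    run-≤-hits (suc m) b x = ℚP.≤-trans
      (𝔼-mono Wᵗ (λ S → run-≤-hits m (suc b) (update b x S)))
      (ℚP.≤-trans (ℚP.≤-reflexive (trans (𝔼-+const Wᵗ (λ S → cost (update b x S) + ℕ→ℚ m * ρ) H′)
          (cong (_+ H′) (𝔼-+const Wᵗ (λ S → cost (update b x S)) (ℕ→ℚ m * ρ)))))
        (ℚP.≤-trans (ℚP.+-monoˡ-≤ H′ (ℚP.+-monoˡ-≤ (ℕ→ℚ m * ρ) (round-≤ b x)))
          (ℚP.≤-reflexive (trans (lemma (cost x) ρ (ℕ→ℚ m) h h′)
            (cong₂ (λ z h → cost x + z * ρ + 2ℚ * h) (sym (ℕ→ℚ-suc m)) (sym
              (trans (𝔼-cong W (λ u → 𝔼-cong W (λ v → ℚP.*-distribˡ-+ (p u v) (hit b u v) (hits (suc b) m u v))))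
                (pairs-+ (λ u v → p u v * hit b u v) (λ u v → p u v * hits (suc b) m u v)))))))))
      where
      Wᵗ = iid W t
      h = pairs (λ u v → p u v * hit b u v)
      h′ = pairs (λ u v → p u v * hits (suc b) m u v)
      H′ = 2ℚ * h′
      lemma : ∀ c r m h h′ → c + r + 2ℚ * h + m * r + 2ℚ * h′ ≡ c + (1ℚ + m) * r + 2ℚ * (h + h′)
      lemma = solve-∀ ℚ-ring

    run-≤ : (∀ u v → 0ℚ ≤ p u v) → ∀ m x → 𝔼 (iid (iid W t) m) (λ Ss → cost (run 0 x Ss)) ≤
      cost x + ℕ→ℚ m * ρ + 2ℚ * pairs (λ u v → p u v * sameBlock u v)
    run-≤ 0≤p m x = ℚP.≤-trans (run-≤-hits m 0 x) (ℚP.+-monoʳ-≤ (cost x + ℕ→ℚ m * ρ)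
      (*-monoˡ 2ℚ 0≤2 (pairs-mono (λ u v → *-monoˡ (p u v) (0≤p u v) (hits-≤ 0 m u v)))))

-- Uniform sums and balanced blocks

sumFin : ∀ {n} → (Fin n → ℚ) → ℚ
sumFin {zero} f = 0ℚ
sumFin {suc n} f = f zero + sumFin (f ∘ suc)

sumFin-mono : ∀ {n} {f g : Fin n → ℚ} → (∀ v → f v ≤ g v) → sumFin f ≤ sumFin g
sumFin-mono {zero} f≤g = ℚP.≤-refl
sumFin-mono {suc n} f≤g = ℚP.+-mono-≤ (f≤g zero) (sumFin-mono (f≤g ∘ suc))

sumFin-cong : ∀ {n} {f g : Fin n → ℚ} → (∀ v → f v ≡ g v) → sumFin f ≡ sumFin g
sumFin-cong {zero} f≗g = refl
sumFin-cong {suc n} f≗g = cong₂ _+_ (f≗g zero) (sumFin-cong (f≗g ∘ suc))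

sumFin-+ : ∀ {n} (f g : Fin n → ℚ) → sumFin (λ v → f v + g v) ≡ sumFin f + sumFin g
sumFin-+ {zero} f g = refl
sumFin-+ {suc n} f g = trans (cong (f zero + g zero +_) (sumFin-+ (f ∘ suc) (g ∘ suc)))
  (interchange (f zero) (g zero) (sumFin (f ∘ suc)) (sumFin (g ∘ suc)))
  where
  interchange : ∀ a b c d → a + b + (c + d) ≡ a + c + (b + d)
  interchange = solve-∀ ℚ-ring

sumFin-* : ∀ {n} c (f : Fin n → ℚ) → sumFin (λ v → c * f v) ≡ c * sumFin f
sumFin-* {zero} c f = sym (ℚP.*-zeroʳ c)
sumFin-* {suc n} c f = trans (cong (c * f zero +_) (sumFin-* c (f ∘ suc)))
  (sym (ℚP.*-distribˡ-+ c (f zero) (sumFin (f ∘ suc))))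

sumFin-const : ∀ n c → sumFin {n} (λ _ → c) ≡ ℕ→ℚ n * c
sumFin-const zero c = sym (ℚP.*-zeroˡ c)
sumFin-const (suc n) c = trans (cong (c +_) (sumFin-const n c))
  (trans (lemma c (ℕ→ℚ n)) (cong (_* c) (sym (ℕ→ℚ-suc n))))
  where
  lemma : ∀ c n → c + n * c ≡ (1ℚ + n) * c
  lemma = solve-∀ ℚ-ring

sumFin-0 : ∀ {n} → sumFin {n} (λ _ → 0ℚ) ≡ 0ℚ
sumFin-0 {n} = trans (sumFin-const n 0ℚ) (ℚP.*-zeroʳ (ℕ→ℚ n))

sumFin-swap : ∀ {m n} (f : Fin m → Fin n → ℚ) →
  sumFin (λ i → sumFin (f i)) ≡ sumFin (λ j → sumFin (λ i → f i j))
sumFin-swap {zero} {n} f = sym (sumFin-0 {n})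
sumFin-swap {suc m} f = trans (cong (sumFin (f zero) +_) (sumFin-swap (f ∘ suc)))
  (sym (sumFin-+ (f zero) (λ j → sumFin (λ i → f (suc i) j))))

uniform : ∀ n .{{_ : ℕ.NonZero n}} → Expectation (Fin n)
uniform n = record
  { 𝔼 = λ f → recip n * sumFin f
  ; 𝔼-mono = λ f≤g → *-monoˡ (recip n) (0≤recip n) (sumFin-mono f≤g)
  ; 𝔼-+ = λ f g → trans (cong (recip n *_) (sumFin-+ f g)) (ℚP.*-distribˡ-+ (recip n) (sumFin f) (sumFin g))
  ; 𝔼-* = λ c f → trans (cong (recip n *_) (sumFin-* c f)) (lemma (recip n) c (sumFin f))
  ; 𝔼-const = λ c → trans (cong (recip n *_) (sumFin-const n c))
      (trans (lemma′ (recip n) (ℕ→ℚ n) c) (trans (cong (_* c) (ℕ→ℚ*recip n)) (ℚP.*-identityˡ c)))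
  }
  where
  lemma : ∀ r c s → r * (c * s) ≡ c * (r * s)
  lemma = solve-∀ ℚ-ring
  lemma′ : ∀ r n c → r * (n * c) ≡ (n * r) * c
  lemma′ = solve-∀ ℚ-ring

argmin : ∀ {k} → (Fin (suc k) → ℚ) → Fin (suc k)
argmin {zero} f = zero
argmin {suc k} f = if f zero ≤ᵇ f (suc (argmin (f ∘ suc))) then zero else suc (argmin (f ∘ suc))

argmin-≤ : ∀ {k} (f : Fin (suc k) → ℚ) i → f (argmin f) ≤ f i
argmin-≤ {zero} f zero = ℚP.≤-refl
argmin-≤ {suc k} f i with f zero ≤ᵇ f (suc (argmin (f ∘ suc))) in e
argmin-≤ {suc k} f zero | true = ℚP.≤-refl
argmin-≤ {suc k} f (suc i) | true =
  ℚP.≤-trans (ℚP.≤ᵇ⇒≤ (subst T (sym e) tt)) (argmin-≤ (f ∘ suc) i)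
argmin-≤ {suc k} f (suc i) | false = argmin-≤ (f ∘ suc) i
argmin-≤ {suc k} f zero | false with ℚP.≤-total (f zero) (f (suc (argmin (f ∘ suc))))
... | inj₁ p = ⊥-elim (subst T e (ℚP.≤⇒≤ᵇ p))
... | inj₂ p = p

below-average : ∀ {k} (P : Expectation (Fin (suc k))) f → ∃ λ v → f v ≤ 𝔼 P f
below-average P f = argmin f , 𝔼-≥ P (argmin-≤ f)

𝟙 : Bool → ℚ
𝟙 b = if b then 1ℚ else 0ℚ

𝟙-≥0 : ∀ b → 0ℚ ≤ 𝟙 b
𝟙-≥0 true = 0≤1
𝟙-≥0 false = ℚP.≤-refl

𝟙-≤1 : ∀ b → 𝟙 b ≤ 1ℚ
𝟙-≤1 true = ℚP.≤-refl
𝟙-≤1 false = 0≤1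

module _ (m : ℕ) where

  blockPairs : ∀ {n} → (Fin n → Fin (suc m)) → ℚ
  blockPairs bl = sumFin (λ u → sumFin (λ v →
    𝟙 (toℕ u ℕ.<ᵇ toℕ v) * 𝟙 (toℕ (bl u) ℕ.≡ᵇ toℕ (bl v))))

  private
    sum-indicator : ∀ {m} (i : Fin m) → sumFin (λ (b : Fin m) → 𝟙 (toℕ b ℕ.≡ᵇ toℕ i)) ≤ 1ℚ
    sum-indicator {suc m} zero = ℚP.≤-reflexive (trans (cong (1ℚ +_) (sumFin-0 {m})) (ℚP.+-identityʳ 1ℚ))
    sum-indicator {suc m} (suc i) = subst (_≤ 1ℚ) (sym (ℚP.+-identityˡ _)) (sum-indicator i)

    drop-zero : ∀ a b → 0ℚ * b + a ≡ a
    drop-zero = solve-∀ ℚ-ring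

    cons : ∀ {n} → Fin (suc m) → (Fin n → Fin (suc m)) → Fin (suc n) → Fin (suc m)
    cons b bl zero = b
    cons b bl (suc v) = bl v

  -- Vertices are inserted one by one into a currently smallest block. Its size is at most the
  -- average, which bounds the number of pairs that the new vertex creates.
  balanced-blocks : ∀ n → Σ (Fin n → Fin (suc m)) λ bl → blockPairs bl ≤ recip (suc m) * (ℕ→ℚ n * ℕ→ℚ n)
  balanced-blocks zero = (λ ()) , ℚP.≤-reflexive (sym (ℚP.*-zeroʳ (recip (suc m))))
  balanced-blocks (suc n) = cons b bl , ℚP.≤-trans
    (ℚP.≤-trans (ℚP.≤-reflexive unfolded) (ℚP.+-mono-≤ (ℚP.≤-trans b-≤ average-≤) bl-≤))
    (≤-by _ (0≤-* (0≤recip (suc m)) (0≤-+ (0≤ℕ→ℚ n) 0≤1))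
      (trans (cong (λ z → recip (suc m) * (z * z)) (ℕ→ℚ-suc n)) (lemma (recip (suc m)) (ℕ→ℚ n))))
    where
    bl = proj₁ (balanced-blocks n)
    bl-≤ = proj₂ (balanced-blocks n)
    U = uniform (suc m)
    size : Fin (suc m) → ℚ
    size b = sumFin (λ (v : Fin n) → 𝟙 (toℕ b ℕ.≡ᵇ toℕ (bl v)))
    b = proj₁ (below-average U size)
    b-≤ = proj₂ (below-average U size)
    average-≤ : 𝔼 U size ≤ recip (suc m) * (ℕ→ℚ n * 1ℚ)
    average-≤ = *-monoˡ (recip (suc m)) (0≤recip (suc m))
      (subst (_≤ ℕ→ℚ n * 1ℚ) (sumFin-swap (λ v (b : Fin (suc m)) → 𝟙 (toℕ b ℕ.≡ᵇ toℕ (bl v))))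
        (subst (sumFin (λ v → sumFin (λ (b : Fin (suc m)) → 𝟙 (toℕ b ℕ.≡ᵇ toℕ (bl v)))) ≤_) (sumFin-const n 1ℚ)
          (sumFin-mono (λ v → sum-indicator (bl v)))))
    unfolded : blockPairs (cons b bl) ≡ size b + blockPairs bl
    unfolded = cong₂ _+_
      (trans (drop-zero (sumFin (λ (v : Fin n) → 1ℚ * 𝟙 (toℕ b ℕ.≡ᵇ toℕ (bl v)))) (𝟙 (toℕ b ℕ.≡ᵇ toℕ b))) (sumFin-cong (λ (v : Fin n) → ℚP.*-identityˡ (𝟙 (toℕ b ℕ.≡ᵇ toℕ (bl v))))))
      (sumFin-cong (λ (u : Fin n) → drop-zero (sumFin (λ (v : Fin n) → 𝟙 (toℕ u ℕ.<ᵇ toℕ v) * 𝟙 (toℕ (bl u) ℕ.≡ᵇ toℕ (bl v)))) (𝟙 (toℕ (bl u) ℕ.≡ᵇ toℕ b))))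
    lemma : ∀ r n → r * ((1ℚ + n) * (1ℚ + n)) ≡ r * (n * 1ℚ) + r * (n * n) + r * (n + 1ℚ)
    lemma = solve-∀ ℚ-ring

-- Labelled clusterings

-- Label zero marks singleton clusters, so it is not even the same as itself.
same : ∀ {k} → Fin (suc k) → Fin (suc k) → Bool
same (suc i) (suc j) = toℕ i ℕ.≡ᵇ toℕ j
same _ _ = false

mismatch : Bool → Bool → ℚ
mismatch a b = if does (a ≟B b) then 0ℚ else 1ℚ

pairLoss : ∀ {n k} → AdjMatrix n → Fin n → Fin n → Fin (suc k) → Fin (suc k) → ℚ
pairLoss G u v i j = 𝟙 (toℕ u ℕ.<ᵇ toℕ v) * mismatch (G u v) (same i j)

mismatch-≥0 : ∀ a b → 0ℚ ≤ mismatch a b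
mismatch-≥0 a b with does (a ≟B b)
... | true = ℚP.≤-refl
... | false = 0≤1

mismatch-≤1 : ∀ a b → mismatch a b ≤ 1ℚ
mismatch-≤1 a b with does (a ≟B b)
... | true = 0≤1
... | false = ℚP.≤-refl

same-sym : ∀ {k} (i j : Fin (suc k)) → same i j ≡ same j i
same-sym zero zero = refl
same-sym zero (suc j) = refl
same-sym (suc i) zero = refl
same-sym (suc i) (suc j) = ≡ᵇ-sym (toℕ i) (toℕ j)
  where
  ≡ᵇ-sym : ∀ a b → (a ℕ.≡ᵇ b) ≡ (b ℕ.≡ᵇ a)
  ≡ᵇ-sym zero zero = refl
  ≡ᵇ-sym zero (suc b) = refl
  ≡ᵇ-sym (suc a) zero = refl
  ≡ᵇ-sym (suc a) (suc b) = ≡ᵇ-sym a b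

same-true : ∀ {k} (i j : Fin (suc k)) → same i j ≡ true → Σ (Fin k) λ l → i ≡ suc l × j ≡ suc l
same-true (suc i) (suc j) e =
  i , refl , cong suc (sym (FinP.toℕ-injective (≡ᵇ-true (toℕ i) (toℕ j) e)))

same-suc : ∀ {k} (i : Fin k) → same (suc i) (suc i) ≡ true
same-suc i = ≡ᵇ-refl (toℕ i)

module _ {n : ℕ} {k : ℕ} (G : AdjMatrix n) where

  pairLoss-≥0 : ∀ u v (i j : Fin (suc k)) → 0ℚ ≤ pairLoss G u v i j
  pairLoss-≥0 u v i j = 0≤-* (𝟙-≥0 (toℕ u ℕ.<ᵇ toℕ v)) (mismatch-≥0 (G u v) (same i j))

  pairLoss-≤ : ∀ u v (i j : Fin (suc k)) → pairLoss G u v i j ≤ 𝟙 (toℕ u ℕ.<ᵇ toℕ v)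
  pairLoss-≤ u v i j = subst (pairLoss G u v i j ≤_) (ℚP.*-identityʳ (𝟙 (toℕ u ℕ.<ᵇ toℕ v)))
    (*-monoˡ (𝟙 (toℕ u ℕ.<ᵇ toℕ v)) (𝟙-≥0 (toℕ u ℕ.<ᵇ toℕ v)) (mismatch-≤1 (G u v) (same i j)))

  pairLoss-≤1 : ∀ u v (i j : Fin (suc k)) → pairLoss G u v i j ≤ 1ℚ
  pairLoss-≤1 u v i j = ℚP.≤-trans (pairLoss-≤ u v i j) (𝟙-≤1 (toℕ u ℕ.<ᵇ toℕ v))

  pairLoss-sym-≤1 : ∀ u v (i j : Fin (suc k)) → pairLoss G u v i j + pairLoss G v u j i ≤ 1ℚ
  pairLoss-sym-≤1 u v i j = ℚP.≤-trans (ℚP.+-mono-≤ (pairLoss-≤ u v i j) (pairLoss-≤ v u j i))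
    (asym (toℕ u) (toℕ v))
    where
    asym : ∀ a b → 𝟙 (a ℕ.<ᵇ b) + 𝟙 (b ℕ.<ᵇ a) ≤ 1ℚ
    asym zero zero = 0≤1
    asym zero (suc b) = ℚP.≤-refl
    asym (suc a) zero = ℚP.≤-refl
    asym (suc a) (suc b) = asym a b

true≢false : true ≢ false
true≢false ()

-- Applied to the incidences of a vertex with the representatives. Taking the first hit gives a
-- whole cluster one label even if it contains several representatives; `zero` means that none was
-- hit.
firstTrue : ∀ {k} → Vec Bool k → Fin (suc k)
firstTrue [] = zero
firstTrue (true ∷ bs) = suc zero
firstTrue (false ∷ bs) with firstTrue bs
... | zero = zero
... | suc i = suc (suc i)

firstTrue-lookup : ∀ {k} (bs : Vec Bool k) i → firstTrue bs ≡ suc i → Vec.lookup bs i ≡ true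
firstTrue-lookup (true ∷ bs) zero refl = refl
firstTrue-lookup (false ∷ bs) i e with firstTrue bs in e′
firstTrue-lookup (false ∷ bs) (suc i) refl | suc .i = firstTrue-lookup bs i e′

firstTrue-none : ∀ {k} (bs : Vec Bool k) → firstTrue bs ≡ zero → prod (λ b → 1ℚ - 𝟙 b) bs ≡ 1ℚ
firstTrue-none [] e = refl
firstTrue-none (false ∷ bs) e with firstTrue bs in e′
... | zero = trans (lemma (prod (λ b → 1ℚ - 𝟙 b) bs)) (firstTrue-none bs e′)
  where
  lemma : ∀ p → (1ℚ - 0ℚ) * p ≡ p
  lemma = solve-∀ ℚ-ring

prod-≥0 : ∀ {A : Set} {t} {f : A → ℚ} → (∀ a → 0ℚ ≤ f a) → (xs : Vec A t) → 0ℚ ≤ prod f xs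
prod-≥0 0≤f [] = 0≤1
prod-≥0 0≤f (x ∷ xs) = 0≤-* (0≤f x) (prod-≥0 0≤f xs)

prod-map : ∀ {A B : Set} {t} (f : B → ℚ) (g : A → B) (xs : Vec A t) → prod f (Vec.map g xs) ≡ prod (f ∘ g) xs
prod-map f g [] = refl
prod-map f g (x ∷ xs) = cong (f (g x) *_) (prod-map f g xs)

^ℚ-≥0 : ∀ {q} → 0ℚ ≤ q → ∀ k → 0ℚ ≤ q ^ℚ k
^ℚ-≥0 0≤q zero = 0≤1
^ℚ-≥0 0≤q (suc k) = 0≤-* 0≤q (^ℚ-≥0 0≤q k)

module _ (p : ℚ) (0≤p : 0ℚ ≤ p) (p≤1 : p ≤ 1ℚ) where
  private
    power-bound : ∀ k → (1ℚ - p) ^ℚ k * (1ℚ + ℕ→ℚ k * p) ≤ 1ℚ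
    power-bound zero = ℚP.≤-reflexive (lemma p)
      where
      lemma : ∀ p → 1ℚ * (1ℚ + 0ℚ * p) ≡ 1ℚ
      lemma = solve-∀ ℚ-ring
    power-bound (suc k) = ℚP.≤-trans (≤-by _
      (0≤-* (^ℚ-≥0 (≤⇒0≤- p≤1) k) (0≤-* (0≤-+ 0≤1 (0≤ℕ→ℚ k)) (0≤-* 0≤p 0≤p)))
      (trans (lemma p ((1ℚ - p) ^ℚ k) (ℕ→ℚ k))
        (cong (λ z → (1ℚ - p) * (1ℚ - p) ^ℚ k * (1ℚ + z * p) + (1ℚ - p) ^ℚ k * ((1ℚ + ℕ→ℚ k) * (p * p)))
          (sym (ℕ→ℚ-suc k)))))
      (power-bound k)
      where
      lemma : ∀ p q k → q * (1ℚ + k * p) ≡ (1ℚ - p) * q * (1ℚ + (1ℚ + k) * p) + q * ((1ℚ + k) * (p * p))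
      lemma = solve-∀ ℚ-ring

  -- A vertex in a cluster of weight `p` is missed by `k` representatives with probability
  -- `(1 - p)^k`, and isolating it costs at most `p`. The product is small for every `p`, so no
  -- threshold between large and small clusters is required. The proof rests on the Bernoulli-type
  -- bound above.
  p[1-p]^k≤ : ∀ k .{{_ : ℕ.NonZero k}} → p * (1ℚ - p) ^ℚ k ≤ recip k
  p[1-p]^k≤ k = ≤-by _ (0≤-* (0≤recip k) (0≤-+ (^ℚ-≥0 (≤⇒0≤- p≤1) k) (≤⇒0≤- (power-bound k))))
    (sym (trans (cong (λ z → z + recip k * (q + (1ℚ - q * (1ℚ + ℕ→ℚ k * p)))) expand)
      (lemma (recip k) q (ℕ→ℚ k) p)))
    where
    q = (1ℚ - p) ^ℚ k
    expand : p * q ≡ recip k * (ℕ→ℚ k * (p * q))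
    expand = trans (sym (ℚP.*-identityˡ (p * q))) (trans (cong (_* (p * q)) (sym (ℕ→ℚ*recip k)))
      (regroup (ℕ→ℚ k) (recip k) (p * q)))
      where
      regroup : ∀ k r x → k * r * x ≡ r * (k * x)
      regroup = solve-∀ ℚ-ring
    lemma : ∀ r q k p → r * (k * (p * q)) + r * (q + (1ℚ - q * (1ℚ + k * p))) ≡ r
    lemma = solve-∀ ℚ-ring

module _ {n : ℕ} (W : Expectation (Fin (suc n))) (fubini : Fubini W) where
  private
    A = Fin (suc n)

  module _ (C : A → A → Bool) where

    degree : A → ℚ
    degree u = 𝔼 W (λ v → 𝟙 (C u v))

    uncovered : ∀ {k} → Vec A k → A → ℚ
    uncovered rs u = prod (λ r → 1ℚ - 𝟙 (C u r)) rs

    -- Method of conditional expectations for i.i.d. representatives.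
    representatives : ∀ k (g : A → ℚ) → Σ (Vec A k) λ rs →
      𝔼 W (λ u → g u * uncovered rs u) ≤ 𝔼 W (λ u → g u * (1ℚ - degree u) ^ℚ k)
    representatives zero g = [] , ℚP.≤-refl
    representatives (suc k) g = (r ∷ rs) ,
      ℚP.≤-trans (ℚP.≤-reflexive (𝔼-cong W (λ u → sym (ℚP.*-assoc (g u) (1ℚ - 𝟙 (C u r)) (uncovered rs u)))))
        (ℚP.≤-trans rs-≤ (ℚP.≤-trans r-≤ (ℚP.≤-reflexive
          (trans (sym (fubini W (λ u r → g u * (1ℚ - 𝟙 (C u r)) * (1ℚ - degree u) ^ℚ k)))
            (𝔼-cong W average)))))
      where
      next : A → ℚ
      next r = 𝔼 W (λ u → g u * (1ℚ - 𝟙 (C u r)) * (1ℚ - degree u) ^ℚ k)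
      r = proj₁ (below-average W next)
      r-≤ = proj₂ (below-average W next)
      -- The representative just chosen is absorbed into the weight, which is why the induction runs
      -- over an arbitrary `g`.
      rs = proj₁ (representatives k (λ u → g u * (1ℚ - 𝟙 (C u r))))
      rs-≤ = proj₂ (representatives k (λ u → g u * (1ℚ - 𝟙 (C u r))))
      average : ∀ u → 𝔼 W (λ r → g u * (1ℚ - 𝟙 (C u r)) * (1ℚ - degree u) ^ℚ k)
        ≡ g u * (1ℚ - degree u) ^ℚ (suc k)
      average u = trans (𝔼-*ʳ W ((1ℚ - degree u) ^ℚ k) (λ r → g u * (1ℚ - 𝟙 (C u r))))
        (trans (cong (_* (1ℚ - degree u) ^ℚ k) (trans (𝔼-* W (g u) (λ r → 1ℚ - 𝟙 (C u r)))
            (cong (g u *_) (trans (𝔼-- W (λ _ → 1ℚ) (λ r → 𝟙 (C u r))) (cong (_- degree u) (𝔼-const W 1ℚ))))))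
          (ℚP.*-assoc (g u) (1ℚ - degree u) ((1ℚ - degree u) ^ℚ k)))

    module _ (C-sym : ∀ u v → C u v ≡ C v u) (C-trans : ∀ u v → C u v ≡ true → ∀ r → C u r ≡ C v r) where

      -- Only pairs inside a cluster without representative change their status. Charging each to
      -- its first endpoint gives the average of degree times `uncovered`, which `representatives`
      -- and `p[1-p]^k≤` bound.
      few-labels : ∀ k .{{_ : ℕ.NonZero k}} (G : AdjMatrix (suc n)) → Σ (A → Fin (suc k)) λ x →
        𝔼 W (λ u → 𝔼 W (λ v → pairLoss G u v (x u) (x v))) ≤
        𝔼 W (λ u → 𝔼 W (λ v → 𝟙 (toℕ u ℕ.<ᵇ toℕ v) * mismatch (G u v) (C u v))) + recip k
      few-labels k G = x , ℚP.≤-trans (𝔼-mono W (λ u → 𝔼-mono W (pointwise u)))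
        (ℚP.≤-trans (ℚP.≤-reflexive (𝔼-+ (W ⊗ W) (λ (u , v) → ψ u v) (λ (u , v) → 𝟙 (C u v) * uncovered rs u)))
          (ℚP.+-monoʳ-≤ (𝔼 W (λ u → 𝔼 W (ψ u)))
            (ℚP.≤-trans (ℚP.≤-reflexive (𝔼-cong W (λ u → 𝔼-*ʳ W (uncovered rs u) (λ v → 𝟙 (C u v)))))
              (ℚP.≤-trans rs-≤ (𝔼-≤ W (λ u → p[1-p]^k≤ (degree u)
                (𝔼-≥ W (λ v → 𝟙-≥0 (C u v))) (𝔼-≤ W (λ v → 𝟙-≤1 (C u v))) k))))))
        where
        rs = proj₁ (representatives k degree)
        rs-≤ = proj₂ (representatives k degree)
        x : A → Fin (suc k)
        x u = firstTrue (Vec.map (C u) rs)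
        ψ : A → A → ℚ
        ψ u v = 𝟙 (toℕ u ℕ.<ᵇ toℕ v) * mismatch (G u v) (C u v)

        uncovered-≥0 : ∀ u → 0ℚ ≤ uncovered rs u
        uncovered-≥0 u = prod-≥0 (λ r → ≤⇒0≤- (𝟙-≤1 (C u r))) rs

        zero-uncovered : ∀ u → x u ≡ zero → uncovered rs u ≡ 1ℚ
        zero-uncovered u e = trans (sym (prod-map (λ b → 1ℚ - 𝟙 b) (C u) rs)) (firstTrue-none (Vec.map (C u) rs) e)

        adjacent : ∀ u v → same (x u) (x v) ≡ true → C u v ≡ true
        adjacent u v e = trans (C-sym u v) (trans (sym (C-trans r v (trans (C-sym r v) (covers v v≡)) u))
            (trans (C-sym r u) (covers u u≡)))
          where
          l = proj₁ (same-true (x u) (x v) e)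
          u≡ = proj₁ (proj₂ (same-true (x u) (x v) e))
          v≡ = proj₂ (proj₂ (same-true (x u) (x v) e))
          r = Vec.lookup rs l
          covers : ∀ w → x w ≡ suc l → C w r ≡ true
          covers w e = trans (sym (VecP.lookup-map l (C w) rs)) (firstTrue-lookup (Vec.map (C w) rs) l e)

        core : ∀ u v → mismatch (G u v) (same (x u) (x v)) ≤ mismatch (G u v) (C u v) + 𝟙 (C u v) * uncovered rs u
        core u v with C u v in e
        ... | false with same (x u) (x v) in e′
        ...   | true = ⊥-elim (true≢false (trans (sym (adjacent u v e′)) e))
        ...   | false = ≤-by _ (0≤-* (𝟙-≥0 false) (uncovered-≥0 u)) refl
        core u v | true with x u in e′
        ... | zero = ℚP.≤-trans (mismatch-≤1 (G u v) _) (≤-by _ (mismatch-≥0 (G u v) true)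
              (trans (cong (λ z → mismatch (G u v) true + 1ℚ * z) (zero-uncovered u e′)) (ℚP.+-comm (mismatch (G u v) true) 1ℚ)))
        -- Related vertices have equal rows of `C`, hence the same first representative, so `v` also
        -- has label `suc i`.
        ... | suc i = ≤-by _ (0≤-* 0≤1 (uncovered-≥0 u))
              (cong (λ z → mismatch (G u v) z + 1ℚ * uncovered rs u)
                (sym (trans (cong (same (suc i)) (trans (sym (cong firstTrue (VecP.map-cong (C-trans u v e) rs))) e′)) (same-suc i))))

        pointwise : ∀ u v → pairLoss G u v (x u) (x v) ≤ ψ u v + 𝟙 (C u v) * uncovered rs u
        pointwise u v with toℕ u ℕ.<ᵇ toℕ v
        ... | true = ℚP.≤-trans (ℚP.≤-reflexive (ℚP.*-identityˡ (mismatch (G u v) (same (x u) (x v))))) (ℚP.≤-trans (core u v)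
              (ℚP.≤-reflexive (cong (_+ 𝟙 (C u v) * uncovered rs u) (sym (ℚP.*-identityˡ (mismatch (G u v) (C u v)))))))
        ... | false = ≤-by _ (0≤-* (𝟙-≥0 (C u v)) (uncovered-≥0 u))
              (cong (_+ 𝟙 (C u v) * uncovered rs u) (trans (ℚP.*-zeroˡ (mismatch (G u v) (C u v))) (sym (ℚP.*-zeroˡ (mismatch (G u v) (same (x u) (x v)))))))

-- Near-uniform vertices from fair coins

module _ {n : ℕ} where
  private
    A = Fin (suc n)

  -- The coins are the binary digits of an integer uniform on `2 ^ N` consecutive values starting at
  -- `a`, reduced modulo the number of vertices. The bias comes only from the incomplete last
  -- period.
  draw : ℕ → ℕ → (A → QTree (suc n)) → QTree (suc n)
  draw zero a k = k (a DivMod.mod suc n)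
  draw (suc N) a k = coin (λ b → draw N (if b then a ℕ.+ 2 ℕ.^ N else a) k)

  drawE : ℕ → ℕ → (A → ℚ) → ℚ
  drawE zero a f = f (a DivMod.mod suc n)
  drawE (suc N) a f = ½ * (drawE N (a ℕ.+ 2 ℕ.^ N) f + drawE N a f)

  draw-success : ∀ N a k G good →
    successProb (draw N a k) G good ≡ drawE N a (λ v → successProb (k v) G good)
  draw-success zero a k G good = refl
  draw-success (suc N) a k G good =
    cong (½ *_) (cong₂ _+_ (draw-success N (a ℕ.+ 2 ℕ.^ N) k G good) (draw-success N a k G good))

  draw-queries : ∀ N a k {B} → (∀ v → queries (k v) ℕ.≤ B) → queries (draw N a k) ℕ.≤ B
  draw-queries zero a k k≤B = k≤B (a DivMod.mod suc n)
  draw-queries (suc N) a k k≤B =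
    ℕP.⊔-lub (draw-queries N (a ℕ.+ 2 ℕ.^ N) k k≤B) (draw-queries N a k k≤B)

  drawn : ℕ → ℕ → Expectation A
  drawn N a = record
    { 𝔼 = drawE N a ; 𝔼-mono = mono N a ; 𝔼-+ = add N a ; 𝔼-* = scale N a ; 𝔼-const = const N a }
    where
    mono : ∀ N a {f g : A → ℚ} → (∀ v → f v ≤ g v) → drawE N a f ≤ drawE N a g
    mono zero a f≤g = f≤g (a DivMod.mod suc n)
    mono (suc N) a f≤g = *-monoˡ ½ 0≤½ (ℚP.+-mono-≤ (mono N (a ℕ.+ 2 ℕ.^ N) f≤g) (mono N a f≤g))
    add : ∀ N a f g → drawE N a (λ v → f v + g v) ≡ drawE N a f + drawE N a g
    add zero a f g = refl
    add (suc N) a f g = trans (cong (½ *_) (cong₂ _+_ (add N (a ℕ.+ 2 ℕ.^ N) f g) (add N a f g)))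
      (lemma (drawE N (a ℕ.+ 2 ℕ.^ N) f) (drawE N (a ℕ.+ 2 ℕ.^ N) g) (drawE N a f) (drawE N a g))
      where
      lemma : ∀ x y z w → ½ * (x + y + (z + w)) ≡ ½ * (x + z) + ½ * (y + w)
      lemma = solve-∀ ℚ-ring
    scale : ∀ N a c f → drawE N a (λ v → c * f v) ≡ c * drawE N a f
    scale zero a c f = refl
    scale (suc N) a c f = trans (cong (½ *_) (cong₂ _+_ (scale N (a ℕ.+ 2 ℕ.^ N) c f) (scale N a c f)))
      (lemma c (drawE N (a ℕ.+ 2 ℕ.^ N) f) (drawE N a f))
      where
      lemma : ∀ c x y → ½ * (c * x + c * y) ≡ c * (½ * (x + y))
      lemma = solve-∀ ℚ-ring
    const : ∀ N a c → drawE N a (λ _ → c) ≡ c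
    const zero a c = refl
    const (suc N) a c = trans (cong (½ *_) (cong₂ _+_ (const N (a ℕ.+ 2 ℕ.^ N) c) (const N a c))) (lemma c)
      where
      lemma : ∀ c → ½ * (c + c) ≡ c
      lemma = solve-∀ ℚ-ring

  drawn-fubini : ∀ N a → Fubini (drawn N a)
  drawn-fubini zero a Q f = refl
  drawn-fubini (suc N) a Q f = trans
    (cong (½ *_) (trans (cong₂ _+_ (drawn-fubini N (a ℕ.+ 2 ℕ.^ N) Q f) (drawn-fubini N a Q f))
      (sym (𝔼-+ Q (λ b → drawE N (a ℕ.+ 2 ℕ.^ N) (λ v → f v b)) (λ b → drawE N a (λ v → f v b))))))
    (sym (𝔼-* Q ½ (λ b → drawE N (a ℕ.+ 2 ℕ.^ N) (λ v → f v b) + drawE N a (λ v → f v b))))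

  sumFrom : ℕ → ℕ → (ℕ → ℚ) → ℚ
  sumFrom a zero g = 0ℚ
  sumFrom a (suc l) g = g a + sumFrom (suc a) l g

  sumFrom-+ : ∀ a l m g → sumFrom a (l ℕ.+ m) g ≡ sumFrom a l g + sumFrom (a ℕ.+ l) m g
  sumFrom-+ a zero m g = trans (cong (λ z → sumFrom z m g) (sym (ℕP.+-identityʳ a))) (sym (ℚP.+-identityˡ (sumFrom (a ℕ.+ 0) m g)))
  sumFrom-+ a (suc l) m g = trans (cong (g a +_) (trans (sumFrom-+ (suc a) l m g)
      (cong (λ z → sumFrom (suc a) l g + sumFrom z m g) (sym (ℕP.+-suc a l)))))
    (sym (ℚP.+-assoc (g a) (sumFrom (suc a) l g) (sumFrom (a ℕ.+ suc l) m g)))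

  sumFrom-≥0 : ∀ a l {g} → (∀ i → 0ℚ ≤ g i) → 0ℚ ≤ sumFrom a l g
  sumFrom-≥0 a zero 0≤g = ℚP.≤-refl
  sumFrom-≥0 a (suc l) 0≤g = 0≤-+ (0≤g a) (sumFrom-≥0 (suc a) l 0≤g)

  sumFrom-Fin : ∀ a l g → sumFrom a l g ≡ sumFin {l} (λ i → g (toℕ i ℕ.+ a))
  sumFrom-Fin a zero g = refl
  sumFrom-Fin a (suc l) g = cong (g a +_) (trans (sumFrom-Fin (suc a) l g)
    (sumFin-cong {l} (λ i → cong g (ℕP.+-suc (toℕ i) a))))

  module _ (f : A → ℚ) where
    private
      g : ℕ → ℚ
      g i = f (i DivMod.mod suc n)

    drawE-sum : ∀ N a → ℕ→ℚ (2 ℕ.^ N) * drawE N a f ≡ sumFrom a (2 ℕ.^ N) g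
    drawE-sum zero a = trans (ℚP.*-identityˡ (g a)) (sym (ℚP.+-identityʳ (g a)))
    drawE-sum (suc N) a = trans (cong (_* (½ * (d + e))) (trans (cong ℕ→ℚ (cong (2 ℕ.^ N ℕ.+_) (ℕP.+-identityʳ (2 ℕ.^ N))))
        (ℕ→ℚ-+ (2 ℕ.^ N) (2 ℕ.^ N))))
      (trans (lemma (ℕ→ℚ (2 ℕ.^ N)) d e) (trans (cong₂ _+_ (drawE-sum N a) (drawE-sum N (a ℕ.+ 2 ℕ.^ N)))
        (trans (sym (sumFrom-+ a (2 ℕ.^ N) (2 ℕ.^ N) g))
          (cong (λ z → sumFrom a (2 ℕ.^ N ℕ.+ z) g) (sym (ℕP.+-identityʳ (2 ℕ.^ N)))))))
      where
      d = drawE N (a ℕ.+ 2 ℕ.^ N) f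
      e = drawE N a f
      lemma : ∀ p d e → (p + p) * (½ * (d + e)) ≡ p * e + p * d
      lemma = solve-∀ ℚ-ring

    mod-period : ∀ (i : A) j → (toℕ i ℕ.+ j ℕ.* suc n) DivMod.mod suc n ≡ i
    mod-period i j = FinP.toℕ-injective (trans (FinP.toℕ-fromℕ< (DivMod.m%n<n (toℕ i ℕ.+ j ℕ.* suc n) (suc n)))
      (trans (DivMod.[m+kn]%n≡m%n (toℕ i) j (suc n)) (DivMod.m<n⇒m%n≡m (FinP.toℕ<n i))))

    period-sum : ∀ c j → sumFrom (j ℕ.* suc n) (c ℕ.* suc n) g ≡ ℕ→ℚ c * sumFin f
    period-sum zero j = sym (ℚP.*-zeroˡ (sumFin f))
    period-sum (suc c) j = trans (sumFrom-+ (j ℕ.* suc n) (suc n) (c ℕ.* suc n) g)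
      (trans (cong₂ _+_
          (trans (sumFrom-Fin (j ℕ.* suc n) (suc n) g) (sumFin-cong (λ i → cong f (mod-period i j))))
          (trans (cong (λ z → sumFrom z (c ℕ.* suc n) g) (ℕP.+-comm (j ℕ.* suc n) (suc n))) (period-sum c (suc j))))
        (trans (lemma (ℕ→ℚ c) (sumFin f)) (cong (_* sumFin f) (sym (ℕ→ℚ-suc c)))))
      where
      lemma : ∀ c s → s + c * s ≡ (1ℚ + c) * s
      lemma = solve-∀ ℚ-ring

    -- The complete periods reproduce the uniform sum exactly. The leftover integers are dropped on
    -- the drawn side and rounded up to one more period on the uniform side, a share of at most
    -- `1/w`.
    uniform-≤-drawn : (∀ v → 0ℚ ≤ f v) → (∀ v → f v ≤ 1ℚ) → ∀ N w .{{_ : ℕ.NonZero w}} →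
      suc n ℕ.* w ℕ.≤ 2 ℕ.^ N → 𝔼 (uniform (suc n)) f ≤ drawE N 0 f + recip w
    uniform-≤-drawn 0≤f f≤1 N w nw≤P = ℚP.*-cancelˡ-≤-pos (ℕ→ℚ P) {{positive}} (ℚP.≤-trans
      (*-monoʳ U (𝔼-≥ (uniform (suc n)) 0≤f) (ℕ→ℚ-mono P≤))
      (ℚP.≤-trans (ℚP.≤-reflexive split) (ℚP.≤-trans (ℚP.+-mono-≤ main remainder)
        (ℚP.≤-reflexive (sym (ℚP.*-distribˡ-+ (ℕ→ℚ P) (drawE N 0 f) (recip w)))))))
      where
      P = 2 ℕ.^ N
      U = 𝔼 (uniform (suc n)) f
      c = P DivMod./ suc n
      positive : ℚ.Positive (ℕ→ℚ P)
      positive = ℚP.normalize-pos P 1 {{_}} {{ℕP.m^n≢0 2 N}}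
      P≡ : P ≡ P DivMod.% suc n ℕ.+ c ℕ.* suc n
      P≡ = DivMod.m≡m%n+[m/n]*n P (suc n)
      P≤ : P ℕ.≤ c ℕ.* suc n ℕ.+ suc n
      P≤ = ℕP.≤-trans (ℕP.≤-reflexive (trans P≡ (ℕP.+-comm (P DivMod.% suc n) (c ℕ.* suc n))))
        (ℕP.+-monoʳ-≤ (c ℕ.* suc n) (ℕP.<⇒≤ (DivMod.m%n<n P (suc n))))
      nU≡ : ℕ→ℚ (suc n) * U ≡ sumFin f
      nU≡ = trans (sym (ℚP.*-assoc (ℕ→ℚ (suc n)) (recip (suc n)) (sumFin f)))
        (trans (cong (_* sumFin f) (ℕ→ℚ*recip (suc n))) (ℚP.*-identityˡ (sumFin f)))
      split : ℕ→ℚ (c ℕ.* suc n ℕ.+ suc n) * U ≡ ℕ→ℚ c * sumFin f + ℕ→ℚ (suc n) * U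
      split = trans (cong (_* U) (trans (ℕ→ℚ-+ (c ℕ.* suc n) (suc n)) (cong (_+ ℕ→ℚ (suc n)) (ℕ→ℚ-* c (suc n)))))
        (trans (lemma (ℕ→ℚ c) (ℕ→ℚ (suc n)) U) (cong (λ z → ℕ→ℚ c * z + ℕ→ℚ (suc n) * U) nU≡))
        where
        lemma : ∀ c n u → (c * n + n) * u ≡ c * (n * u) + n * u
        lemma = solve-∀ ℚ-ring
      main : ℕ→ℚ c * sumFin f ≤ ℕ→ℚ P * drawE N 0 f
      main = ≤-by (sumFrom (c ℕ.* suc n) (P DivMod.% suc n) g)
        (sumFrom-≥0 (c ℕ.* suc n) (P DivMod.% suc n) (λ i → 0≤f (i DivMod.mod suc n)))
        (trans (drawE-sum N 0) (trans (cong (λ z → sumFrom 0 z g)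
            (trans P≡ (ℕP.+-comm (P DivMod.% suc n) (c ℕ.* suc n))))
          (trans (sumFrom-+ 0 (c ℕ.* suc n) (P DivMod.% suc n) g)
            (cong (_+ sumFrom (c ℕ.* suc n) (P DivMod.% suc n) g) (period-sum c 0)))))
      remainder : ℕ→ℚ (suc n) * U ≤ ℕ→ℚ P * recip w
      remainder = ℚP.≤-trans (*-monoˡ (ℕ→ℚ (suc n)) (0≤ℕ→ℚ (suc n)) (𝔼-≤ (uniform (suc n)) f≤1))
        (ℚP.≤-trans (ℚP.≤-reflexive (trans (cong (ℕ→ℚ (suc n) *_) (sym (ℕ→ℚ*recip w)))
            (trans (sym (ℚP.*-assoc (ℕ→ℚ (suc n)) (ℕ→ℚ w) (recip w))) (cong (_* recip w) (sym (ℕ→ℚ-* (suc n) w))))))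
          (*-monoʳ (recip w) (0≤recip w) (ℕ→ℚ-mono nw≤P)))

  -- Closeness in total variation, tested on functions with values between 0 and 1. One direction is
  -- recorded, since replacing `f` by its complement yields the other.
  record Near (P Q : Expectation A) (δ : ℚ) : Set where
    field
      near : ∀ f → (∀ v → 0ℚ ≤ f v) → (∀ v → f v ≤ 1ℚ) → 𝔼 P f ≤ 𝔼 Q f + δ

  near-sym : ∀ {P Q δ} → Near P Q δ → Near Q P δ
  near-sym {P} {Q} {δ} P≈Q = record { near = λ f 0≤f f≤1 → 0≤-⇒≤ (subst (0ℚ ≤_)
    (trans (cong₂ (λ x y → x + δ - y) (complement Q f) (complement P f)) (lemma (𝔼 Q f) (𝔼 P f) δ))
    (≤⇒0≤- (Near.near P≈Q (λ v → 1ℚ - f v) (λ v → ≤⇒0≤- (f≤1 v)) (λ v → ≤-by (f v) (0≤f v) (back (f v)))))) }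
    where
    back : ∀ x → 1ℚ ≡ 1ℚ - x + x
    back = solve-∀ ℚ-ring
    complement : ∀ R f → 𝔼 R (λ v → 1ℚ - f v) ≡ 1ℚ - 𝔼 R f
    complement R f = trans (𝔼-- R (λ _ → 1ℚ) f) (cong (_- 𝔼 R f) (𝔼-const R 1ℚ))
    lemma : ∀ q p δ → (1ℚ - q) + δ - (1ℚ - p) ≡ p + δ - q
    lemma = solve-∀ ℚ-ring

  near-pairs : ∀ {P Q δ} → Near P Q δ → ∀ (f : A → A → ℚ) → (∀ u v → 0ℚ ≤ f u v) → (∀ u v → f u v ≤ 1ℚ) →
    𝔼 P (λ u → 𝔼 P (f u)) ≤ 𝔼 Q (λ u → 𝔼 Q (f u)) + 2ℚ * δ
  near-pairs {P} {Q} {δ} P≈Q f 0≤f f≤1 = ℚP.≤-trans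
    (𝔼-mono P (λ u → Near.near P≈Q (f u) (0≤f u) (f≤1 u)))
    (ℚP.≤-trans (ℚP.≤-reflexive (𝔼-+const P (λ u → 𝔼 Q (f u)) δ))
      (ℚP.≤-trans (ℚP.+-monoˡ-≤ δ (Near.near P≈Q (λ u → 𝔼 Q (f u)) (λ u → 𝔼-≥ Q (0≤f u)) (λ u → 𝔼-≤ Q (f≤1 u))))
        (ℚP.≤-reflexive (lemma (𝔼 Q (λ u → 𝔼 Q (f u))) δ))))
    where
    lemma : ∀ q δ → q + δ + δ ≡ q + 2ℚ * δ
    lemma = solve-∀ ℚ-ring

  uniform-near-drawn : ∀ N w .{{_ : ℕ.NonZero w}} → suc n ℕ.* w ℕ.≤ 2 ℕ.^ N →
    Near (uniform (suc n)) (drawn N 0) (recip w)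
  uniform-near-drawn N w nw≤P = record { near = λ f 0≤f f≤1 → uniform-≤-drawn f 0≤f f≤1 N w nw≤P }

-- The query algorithm

-- A stage in continuation-passing form that only tosses coins: success probabilities become
-- expectations, and a query bound of the continuation carries over unchanged.
record Sampler (n : ℕ) (A : Set) : Set₁ where
  field
    sample : (A → QTree n) → QTree n
    law : Expectation A
    sample-success : ∀ k G good → successProb (sample k) G good ≡ 𝔼 law (λ a → successProb (k a) G good)
    sample-queries : ∀ k {B} → (∀ a → queries (k a) ℕ.≤ B) → queries (sample k) ℕ.≤ B

open Sampler

module _ {n : ℕ} where

  vertexSampler : ℕ → Sampler (suc n) (Fin (suc n))
  vertexSampler N = record
    { sample = draw N 0 ; law = drawn N 0 ; sample-success = draw-success N 0 ; sample-queries = draw-queries N 0 }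

  pairSampler : ∀ {A B} → Sampler n A → Sampler n B → Sampler n (A × B)
  pairSampler P Q = record
    { sample = λ k → sample P (λ a → sample Q (λ b → k (a , b)))
    ; law = law P ⊗ law Q
    ; sample-success = λ k G good → trans (sample-success P _ G good)
        (𝔼-cong (law P) (λ a → sample-success Q (λ b → k (a , b)) G good))
    ; sample-queries = λ k k≤B → sample-queries P _ (λ a → sample-queries Q _ (λ b → k≤B (a , b)))
    }

  iidSampler : ∀ {A} → Sampler n A → ∀ t → Sampler n (Vec A t)
  iidSampler P t = record
    { sample = samples t ; law = iid (law P) t ; sample-success = success t ; sample-queries = bound t }
    where
    samples : ∀ t → (Vec _ t → QTree n) → QTree n
    samples zero k = k []
    samples (suc t) k = sample P (λ a → samples t (λ as → k (a ∷ as)))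
    success : ∀ t k G good →
      successProb (samples t k) G good ≡ 𝔼 (iid (law P) t) (λ as → successProb (k as) G good)
    success zero k G good = refl
    success (suc t) k G good = trans (sample-success P _ G good)
      (𝔼-cong (law P) (λ a → success t (λ as → k (a ∷ as)) G good))
    bound : ∀ t k {B} → (∀ as → queries (k as) ℕ.≤ B) → queries (samples t k) ℕ.≤ B
    bound zero k k≤B = k≤B []
    bound (suc t) k k≤B = sample-queries P _ (λ a → bound t _ (λ as → k≤B (a ∷ as)))

-- A deterministic stage whose answer is a function of the graph, at the price of at most `c`
-- queries. All coins of the algorithm are tossed before its first probe.
record Probe (n : ℕ) (A : Set) (c : ℕ) : Set where
  field
    ask : (A → QTree n) → QTree n
    answer : AdjMatrix n → A
    ask-success : ∀ k G good → successProb (ask k) G good ≡ successProb (k (answer G)) G good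
    ask-queries : ∀ k {B} → (∀ a → queries (k a) ℕ.≤ B) → queries (ask k) ℕ.≤ c ℕ.+ B

open Probe

module _ {n : ℕ} where

  edgeProbe : Fin n → Fin n → Probe n Bool 1
  edgeProbe u v = record
    { ask = query u v ; answer = λ G → G u v ; ask-success = λ _ _ _ → refl
    ; ask-queries = λ k k≤B → ℕ.s≤s (ℕP.⊔-lub (k≤B true) (k≤B false)) }

  pairProbe : ∀ {A B c d} → Probe n A c → Probe n B d → Probe n (A × B) (c ℕ.+ d)
  pairProbe {c = c} {d} P Q = record
    { ask = λ k → ask P (λ a → ask Q (λ b → k (a , b)))
    ; answer = λ G → answer P G , answer Q G
    ; ask-success = λ k G good → trans (ask-success P _ G good) (ask-success Q _ G good)
    ; ask-queries = λ k {B} k≤B → ℕP.≤-trans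
        (ask-queries P _ (λ a → ask-queries Q _ (λ b → k≤B (a , b)))) (ℕP.≤-reflexive (sym (ℕP.+-assoc c d B)))
    }

  tagProbe : ∀ {A B c} → B → Probe n A c → Probe n (B × A) c
  tagProbe b P = record
    { ask = λ k → ask P (λ a → k (b , a)) ; answer = λ G → b , answer P G
    ; ask-success = λ k → ask-success P _
    ; ask-queries = λ k k≤B → ask-queries P _ (λ a → k≤B (b , a)) }

  allProbe : ∀ {X A : Set} {c} → (X → Probe n A c) → ∀ {t} → Vec X t → Probe n (Vec A t) (t ℕ.* c)
  allProbe {A = A} {c} P xs = record
    { ask = asks xs ; answer = λ G → Vec.map (λ x → answer (P x) G) xs
    ; ask-success = success xs ; ask-queries = bound xs }
    where
    asks : ∀ {t} → Vec _ t → (Vec A t → QTree n) → QTree n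
    asks [] k = k []
    asks (x ∷ xs) k = ask (P x) (λ a → asks xs (λ as → k (a ∷ as)))
    success : ∀ {t} (xs : Vec _ t) k G good →
      successProb (asks xs k) G good ≡ successProb (k (Vec.map (λ x → answer (P x) G) xs)) G good
    success [] k G good = refl
    success (x ∷ xs) k G good = trans (ask-success (P x) _ G good) (success xs _ G good)
    bound : ∀ {t} (xs : Vec _ t) k {B} → (∀ as → queries (k as) ℕ.≤ B) → queries (asks xs k) ℕ.≤ t ℕ.* c ℕ.+ B
    bound [] k k≤B = k≤B []
    bound {suc t} (x ∷ xs) k {B} k≤B = ℕP.≤-trans
      (ask-queries (P x) _ (λ a → bound xs _ (λ as → k≤B (a ∷ as))))
      (ℕP.≤-reflexive (sym (ℕP.+-assoc c (t ℕ.* c) B)))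

-- The default values, 1 here and 0 for the maximum, are the extreme values of a loss; they reappear
-- as side conditions when an extremum is shown to be attained.
minOver : ∀ {A : Set} {t} → (A → ℚ) → Vec A t → ℚ
minOver f [] = 1ℚ
minOver f (x ∷ xs) = f x ⊓ minOver f xs

maxOver : ∀ {A : Set} {t} → (A → ℚ) → Vec A t → ℚ
maxOver f [] = 0ℚ
maxOver f (x ∷ xs) = f x ⊔ maxOver f xs

allVecs : ∀ {A : Set} {K} → Vec A K → ∀ t → Vec (Vec A t) (K ℕ.^ t)
allVecs xs zero = [] ∷ []
allVecs xs (suc t) = Vec.map (λ (x , ys) → x ∷ ys) (Vec.allPairs xs (allVecs xs t))

∈-allVecs : ∀ {A : Set} {K} {xs : Vec A K} → (∀ x → x ∈ xs) → ∀ {t} (ys : Vec A t) → ys ∈ allVecs xs t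
∈-allVecs all∈ [] = here refl
∈-allVecs all∈ (y ∷ ys) = VecM.∈-map⁺ (λ (x , ys) → x ∷ ys) (VecM.∈-allPairs⁺ (all∈ y) (∈-allVecs all∈ ys))

module Algo (n : ℕ) (bl : Fin (suc n) → ℕ) (N k m t r s : ℕ) where

  V Lab : Set
  V = Fin (suc n)
  Lab = Fin (suc k)

  -- One answer per sample vertex serves both orders of the pair, of which at most one is counted.
  empiricalLoss : ∀ {t} → V → Lab → Vec Lab t → Vec V t → Vec Bool t → ℚ
  empiricalLoss v c [] [] [] = 0ℚ
  empiricalLoss v c (l ∷ ℓ) (w ∷ S) (g ∷ gs) =
    (𝟙 (toℕ w ℕ.<ᵇ toℕ v) * mismatch g (same l c) + 𝟙 (toℕ v ℕ.<ᵇ toℕ w) * mismatch g (same c l))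
      + empiricalLoss v c ℓ S gs

  choose : Vec Lab t → Vec V t → V → Vec Bool t → Lab
  choose ℓ S v gs = argmin (λ c → empiricalLoss v c ℓ S gs)

  hypLabel : ∀ {m} → ℕ → Lab → V → Vec (Vec Lab t) m → Vec (Vec V t) m → Vec (Vec Bool t) m → Lab
  hypLabel b c v [] [] [] = c
  hypLabel b c v (ℓ ∷ ℓs) (S ∷ Ss) (gs ∷ gss) =
    hypLabel (suc b) (if bl v ℕ.≡ᵇ b then choose ℓ S v gs else c) v ℓs Ss gss

  -- A `Datum` holds a test pair, its adjacency, and the adjacencies of both endpoints to all
  -- samples. This determines the loss of every hypothesis on the pair, so the number of hypotheses
  -- does not enter the query count.
  Samples Hyp Row Datum : Set
  Samples = Vec (Vec V t) m
  Hyp = Vec (Vec Lab t) m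
  Row = Vec (Vec Bool t) m
  Datum = (V × V) × (Bool × (Row × Row))

  hypLoss : Samples → Hyp → Datum → ℚ
  hypLoss Ss ℓs ((u , v) , (g , (gu , gv))) =
    𝟙 (toℕ u ℕ.<ᵇ toℕ v) * mismatch g (same (hypLabel 0 zero u ℓs Ss gu) (hypLabel 0 zero v ℓs Ss gv))

  hyps : Vec Hyp ((suc k ℕ.^ t) ℕ.^ m)
  hyps = allVecs (allVecs (Vec.allFin (suc k)) t) m

  -- The maximum over independent repetitions makes an underestimate exponentially unlikely, as the union
  -- bound over all hypotheses requires; an overestimate has to be excluded for a single hypothesis only.
  estimate : Samples → Vec (Vec Datum s) r → ℚ
  estimate Ss Ds = minOver (λ ℓs → maxOver (mean (hypLoss Ss ℓs)) Ds) hyps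

  rowProbe : Samples → V → Probe (suc n) Row (m ℕ.* (t ℕ.* 1))
  rowProbe Ss v = allProbe (allProbe (edgeProbe v)) Ss

  datumProbe : Samples → V × V → Probe (suc n) Datum (1 ℕ.+ (m ℕ.* (t ℕ.* 1) ℕ.+ m ℕ.* (t ℕ.* 1)))
  datumProbe Ss (u , v) = tagProbe (u , v) (pairProbe (edgeProbe u v) (pairProbe (rowProbe Ss u) (rowProbe Ss v)))

  samplesSampler : Sampler (suc n) Samples
  samplesSampler = iidSampler (iidSampler (vertexSampler N) t) m

  testsSampler : Sampler (suc n) (Vec (Vec (V × V) s) r)
  testsSampler = iidSampler (iidSampler (pairSampler (vertexSampler N) (vertexSampler N)) s) r

  dataProbe : Samples → (T : Vec (Vec (V × V) s) r) → Probe (suc n) (Vec (Vec Datum s) r) _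
  dataProbe Ss T = allProbe (allProbe (datumProbe Ss)) T

  tree : QTree (suc n)
  tree = sample samplesSampler (λ Ss → sample testsSampler (λ T → ask (dataProbe Ss T) (λ Ds → output (estimate Ss Ds))))

  tree-queries : queries tree ℕ.≤ r ℕ.* (s ℕ.* (1 ℕ.+ (m ℕ.* (t ℕ.* 1) ℕ.+ m ℕ.* (t ℕ.* 1)))) ℕ.+ 0
  tree-queries = sample-queries samplesSampler _ (λ Ss → sample-queries testsSampler _ (λ T →
    ask-queries (dataProbe Ss T) _ (λ Ds → ℕ.z≤n)))

  tree-success : ∀ G good → successProb tree G good ≡
    𝔼 (law samplesSampler) (λ Ss → 𝔼 (law testsSampler) (λ T →
      𝟙 (good (estimate Ss (Vec.map (Vec.map (λ p → answer (datumProbe Ss p) G)) T)))))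
  tree-success G good = trans (sample-success samplesSampler _ G good) (𝔼-cong (law samplesSampler) (λ Ss →
    trans (sample-success testsSampler _ G good) (𝔼-cong (law testsSampler) (λ T →
      ask-success (dataProbe Ss T) _ G good))))

-- Analysis of the min-max estimate

minOver-≤ : ∀ {A : Set} {t} (f : A → ℚ) {xs : Vec A t} {x} → x ∈ xs → minOver f xs ≤ f x
minOver-≤ f {_ ∷ xs} (here refl) = ℚP.p⊓q≤p (f _) (minOver f xs)
minOver-≤ f {y ∷ xs} (there x∈) = ℚP.≤-trans (ℚP.p⊓q≤q (f y) (minOver f xs)) (minOver-≤ f x∈)

minOver-attained : ∀ {A : Set} {t} (f : A → ℚ) (xs : Vec A t) {b} → minOver f xs < b → b ≤ 1ℚ →
  Σ A λ x → x ∈ xs × f x < b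
minOver-attained f [] 1<b b≤1 = ⊥-elim (ℚP.<-irrefl refl (ℚP.<-≤-trans 1<b b≤1))
minOver-attained f (x ∷ xs) <b b≤1 with ℚP.⊓-sel (f x) (minOver f xs)
... | inj₁ e = x , here refl , subst (_< _) e <b
... | inj₂ e = let (y , y∈ , fy<b) = minOver-attained f xs (subst (_< _) e <b) b≤1 in y , there y∈ , fy<b

maxOver-≥ : ∀ {A : Set} {t} (f : A → ℚ) {xs : Vec A t} {x} → x ∈ xs → f x ≤ maxOver f xs
maxOver-≥ f {_ ∷ xs} (here refl) = ℚP.p≤p⊔q (f _) (maxOver f xs)
maxOver-≥ f {y ∷ xs} (there x∈) = ℚP.≤-trans (maxOver-≥ f x∈) (ℚP.p≤q⊔p (f y) (maxOver f xs))

maxOver-attained : ∀ {A : Set} {t} (f : A → ℚ) (xs : Vec A t) {b} → b < maxOver f xs → 0ℚ ≤ b →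
  Σ A λ x → x ∈ xs × b < f x
maxOver-attained f [] b<0 0≤b = ⊥-elim (ℚP.<-irrefl refl (ℚP.<-≤-trans b<0 0≤b))
maxOver-attained f (x ∷ xs) b< 0≤b with ℚP.⊔-sel (f x) (maxOver f xs)
... | inj₁ e = x , here refl , subst (_ <_) e b<
... | inj₂ e = let (y , y∈ , b<fy) = maxOver-attained f xs (subst (_ <_) e b<) 0≤b in y , there y∈ , b<fy

prod-≥1 : ∀ {A : Set} {t} {f : A → ℚ} (xs : Vec A t) → (∀ {x} → x ∈ xs → 1ℚ ≤ f x) → 1ℚ ≤ prod f xs
prod-≥1 [] 1≤f = ℚP.≤-refl
prod-≥1 {f = f} (x ∷ xs) 1≤f = ℚP.≤-trans (ℚP.≤-reflexive (sym (ℚP.*-identityˡ 1ℚ)))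
  (*-mono 0≤1 (ℚP.≤-trans 0≤1 (prod-≥1 xs (1≤f ∘ there))) (1≤f (here refl)) (prod-≥1 xs (1≤f ∘ there)))

^ℚ-mono : ∀ {p q} → 0ℚ ≤ p → p ≤ q → ∀ k → p ^ℚ k ≤ q ^ℚ k
^ℚ-mono 0≤p p≤q zero = ℚP.≤-refl
^ℚ-mono 0≤p p≤q (suc k) = *-mono 0≤p (^ℚ-≥0 (ℚP.≤-trans 0≤p p≤q) k) p≤q (^ℚ-mono 0≤p p≤q k)

module MinMax {X L : Set} (P : Expectation X) {q : ℕ} (hs : Vec L q) (F : L → X → ℚ)
  (F≥0 : ∀ ℓ a → 0ℚ ≤ F ℓ a) (F≤1 : ∀ ℓ a → F ℓ a ≤ 1ℚ)
  (s r : ℕ) {{_ : ℕ.NonZero s}}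
  (Γ γ : ℚ) (0≤Γ : 0ℚ ≤ Γ) (Γγ≡1 : Γ * γ ≡ 1ℚ)
  where

  risk : L → ℚ
  risk ℓ = 𝔼 P (F ℓ)

  est : Vec (Vec X s) r → ℚ
  est T = minOver (λ ℓ → maxOver (mean (F ℓ)) T) hs

  -- Chebyshev in pointwise form: the value is at least 1 as soon as a batch mean misses the risk by
  -- `γ`.
  deviation : L → Vec X s → ℚ
  deviation ℓ D = (Γ * Γ) * ((mean (F ℓ) D - risk ℓ) * (mean (F ℓ) D - risk ℓ))

  deviation-≥0 : ∀ ℓ D → 0ℚ ≤ deviation ℓ D
  deviation-≥0 ℓ D = 0≤-* (0≤-* 0≤Γ 0≤Γ) (0≤-sq (mean (F ℓ) D - risk ℓ))

  κ : ℚ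
  κ = (Γ * Γ) * recip s

  𝔼-deviation : ∀ ℓ → 𝔼 (iid P s) (deviation ℓ) ≤ κ
  𝔼-deviation ℓ = ℚP.≤-trans (ℚP.≤-reflexive (𝔼-* (iid P s) (Γ * Γ) _))
    (*-monoˡ (Γ * Γ) (0≤-* 0≤Γ 0≤Γ) (mean-variance P (F ℓ) s (F≥0 ℓ) (F≤1 ℓ)))

  private
    square-≥1 : ∀ {y} → γ ≤ y → 0ℚ ≤ γ → 1ℚ ≤ (Γ * Γ) * (y * y)
    square-≥1 {y} γ≤y 0≤γ = ℚP.≤-trans (ℚP.≤-reflexive (sym (trans (lemma Γ γ) (trans (cong₂ _*_ Γγ≡1 Γγ≡1) (ℚP.*-identityˡ 1ℚ)))))
      (*-monoˡ (Γ * Γ) (0≤-* 0≤Γ 0≤Γ) (*-mono 0≤γ (ℚP.≤-trans 0≤γ γ≤y) γ≤y γ≤y))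
      where
      lemma : ∀ Γ γ → (Γ * Γ) * (γ * γ) ≡ (Γ * γ) * (Γ * γ)
      lemma = solve-∀ ℚ-ring

  module Error (0≤γ : 0ℚ ≤ γ) (ℓ* : L) (ℓ*∈ : ℓ* ∈ hs) (Δ ε a M slack : ℚ)
    (0≤ε : 0ℚ ≤ ε) (0≤M : 0ℚ ≤ M) (Ma≡1 : M * a ≡ 1ℚ) (0≤Δ : 0ℚ ≤ Δ) (Δ≤1 : Δ ≤ 1ℚ) (0≤slack : 0ℚ ≤ slack)
    (a+γ≤ε : a + γ ≤ ε) (slack+γ≤ε : slack + γ ≤ ε)
    (risk-≥ : ∀ ℓ → Δ - slack ≤ risk ℓ)
    where

    -- The term `slack` makes this quantity nonnegative, as Markov's argument demands: the risk
    -- itself can lie below `Δ` by that much.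
    excess : ℚ
    excess = risk ℓ* - Δ + slack

    excess-≥0 : 0ℚ ≤ excess
    excess-≥0 = subst (0ℚ ≤_) (lemma (risk ℓ*) Δ slack) (≤⇒0≤- (risk-≥ ℓ*))
      where
      lemma : ∀ r d s → r - (d - s) ≡ r - d + s
      lemma = solve-∀ ℚ-ring

    -- One summand for each way to fail: `ℓ*` is itself a poor hypothesis, some hypothesis is
    -- underestimated in every batch, or `ℓ*` is overestimated in some batch.
    penalty : Vec (Vec X s) r → ℚ
    penalty T = (M * excess + total (λ ℓ → prod (deviation ℓ) T) hs) + total (deviation ℓ*) T

    private
      B₁-≥0 : 0ℚ ≤ M * excess
      B₁-≥0 = 0≤-* 0≤M excess-≥0
      B₂-≥0 : ∀ (T : Vec (Vec X s) r) → 0ℚ ≤ total (λ ℓ → prod (deviation ℓ) T) hs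
      B₂-≥0 T = total-≥0 (λ ℓ → prod-≥0 (deviation-≥0 ℓ) T) hs
      B₃-≥0 : ∀ (T : Vec (Vec X s) r) → 0ℚ ≤ total (deviation ℓ*) T
      B₃-≥0 T = total-≥0 (deviation-≥0 ℓ*) T

    penalty-≥0 : ∀ T → 0ℚ ≤ penalty T
    penalty-≥0 T = 0≤-+ (0≤-+ B₁-≥0 (B₂-≥0 T)) (B₃-≥0 T)

    -- The minimum is attained at some hypothesis, and its maximum over the batches is low, so every
    -- batch deviates and the whole product is at least 1.
    too-low : ∀ T → est T < Δ - ε → 1ℚ ≤ penalty T
    too-low T est< = let (ℓ , ℓ∈ , max<) = minOver-attained _ hs est< Δ-ε≤1 in
      ℚP.≤-trans (prod-≥1 T (λ {D} D∈ → far ℓ D (ℚP.<⇒≤ (ℚP.≤-<-trans (maxOver-≥ (mean (F ℓ)) D∈) max<))))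
        (ℚP.≤-trans (∈-≤-total (λ ℓ → prod-≥0 (deviation-≥0 ℓ) T) ℓ∈)
          (≤-by _ (0≤-+ B₁-≥0 (B₃-≥0 T)) (lemma (M * excess) (total (λ ℓ → prod (deviation ℓ) T) hs) (total (deviation ℓ*) T))))
      where
      lemma : ∀ x y z → x + y + z ≡ y + (x + z)
      lemma = solve-∀ ℚ-ring
      Δ-ε≤1 : Δ - ε ≤ 1ℚ
      Δ-ε≤1 = ℚP.≤-trans (≤-by ε 0≤ε (lemma′ Δ ε)) Δ≤1
        where
        lemma′ : ∀ d e → d ≡ d - e + e
        lemma′ = solve-∀ ℚ-ring
      far : ∀ ℓ D → mean (F ℓ) D ≤ Δ - ε → 1ℚ ≤ deviation ℓ D
      far ℓ D Y≤ = subst (λ z → 1ℚ ≤ (Γ * Γ) * z) (neg-square (mean (F ℓ) D) (risk ℓ))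
        (square-≥1 (≤-by _ (0≤-+ (≤⇒0≤- Y≤) (0≤-+ (≤⇒0≤- (risk-≥ ℓ)) (≤⇒0≤- slack+γ≤ε)))
          (gap (mean (F ℓ) D) (risk ℓ) Δ ε slack γ)) 0≤γ)
        where
        neg-square : ∀ y r → (r - y) * (r - y) ≡ (y - r) * (y - r)
        neg-square = solve-∀ ℚ-ring
        gap : ∀ y r d e s g → r - y ≡ g + ((d - e - y) + ((r - (d - s)) + (e - (s + g))))
        gap = solve-∀ ℚ-ring

    -- The minimum is at most the value at `ℓ*`. Either the risk of `ℓ*` is already too large, or
    -- one of its batches overshoots a moderate risk.
    too-high : ∀ T → Δ + ε < est T → 1ℚ ≤ penalty T
    too-high T est> with ℚP.≤-total (risk ℓ*) (Δ + a)
    ... | inj₂ risk> = ℚP.≤-trans (ℚP.≤-reflexive (sym Ma≡1)) (ℚP.≤-trans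
        (*-monoˡ M 0≤M (≤-by _ (0≤-+ (≤⇒0≤- risk>) 0≤slack) (gap (risk ℓ*) Δ a slack)))
        (≤-by _ (0≤-+ (B₂-≥0 T) (B₃-≥0 T)) (ℚP.+-assoc (M * excess) _ _)))
      where
      gap : ∀ r d a s → r - d + s ≡ a + ((r - (d + a)) + s)
      gap = solve-∀ ℚ-ring
    ... | inj₁ risk≤ = let (D , D∈ , Y>) = maxOver-attained (mean (F ℓ*)) T
                             (ℚP.<-≤-trans est> (minOver-≤ (λ ℓ → maxOver (mean (F ℓ)) T) ℓ*∈)) (0≤-+ 0≤Δ 0≤ε) in
        ℚP.≤-trans (far D (ℚP.<⇒≤ Y>)) (ℚP.≤-trans (∈-≤-total (deviation-≥0 ℓ*) D∈)
          (≤-by _ (0≤-+ B₁-≥0 (B₂-≥0 T)) (ℚP.+-comm (M * excess + total (λ ℓ → prod (deviation ℓ) T) hs) (total (deviation ℓ*) T))))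
      where
      far : ∀ D → Δ + ε ≤ mean (F ℓ*) D → 1ℚ ≤ deviation ℓ* D
      far D Y≥ = square-≥1 (≤-by _ (0≤-+ (≤⇒0≤- Y≥) (0≤-+ (≤⇒0≤- risk≤) (≤⇒0≤- a+γ≤ε)))
        (gap (mean (F ℓ*) D) (risk ℓ*) Δ ε a γ)) 0≤γ
        where
        gap : ∀ y r d e a g → y - r ≡ g + ((y - (d + e)) + ((d + a - r) + (e - (a + g))))
        gap = solve-∀ ℚ-ring

    private
      nonpos : ∀ {p} → 1ℚ ≤ p → 1ℚ - p ≤ 0ℚ
      nonpos {p} 1≤p = ≤-by _ (≤⇒0≤- 1≤p) (lemma p)
        where
        lemma : ∀ p → 0ℚ ≡ 1ℚ - p + (p - 1ℚ)
        lemma = solve-∀ ℚ-ring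

    success-≥ : (good : ℚ → Bool) → (∀ x → Δ - ε ≤ x → x ≤ Δ + ε → good x ≡ true) →
      ∀ T → 1ℚ - penalty T ≤ 𝟙 (good (est T))
    success-≥ good good-true T with Δ - ε ℚP.≤? est T | est T ℚP.≤? Δ + ε
    ... | yes ≥Δ-ε | yes ≤Δ+ε = subst (λ b → 1ℚ - penalty T ≤ 𝟙 b) (sym (good-true (est T) ≥Δ-ε ≤Δ+ε))
            (≤-by _ (penalty-≥0 T) (lemma (penalty T)))
      where
      lemma : ∀ p → 1ℚ ≡ 1ℚ - p + p
      lemma = solve-∀ ℚ-ring
    ... | no ≱ | _ = ℚP.≤-trans (nonpos (too-low T (ℚP.≰⇒> ≱))) (𝟙-≥0 (good (est T)))
    ... | yes _ | no ≰ = ℚP.≤-trans (nonpos (too-high T (ℚP.≰⇒> ≰))) (𝟙-≥0 (good (est T)))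

    -- Independence of the batches turns the expected product into an `r`-th power, while the sum
    -- for `ℓ*` grows only linearly in `r`.
    𝔼-penalty : 𝔼 (iid (iid P s) r) penalty ≤ (M * excess + ℕ→ℚ q * κ ^ℚ r) + ℕ→ℚ r * κ
    𝔼-penalty = ℚP.≤-trans (ℚP.≤-reflexive (trans
        (𝔼-+ Pʳ (λ T → M * excess + total (λ ℓ → prod (deviation ℓ) T) hs) (total (deviation ℓ*)))
        (cong (_+ 𝔼 Pʳ (total (deviation ℓ*))) (trans (𝔼-+ Pʳ (λ _ → M * excess) (λ T → total (λ ℓ → prod (deviation ℓ) T) hs))
          (cong (_+ 𝔼 Pʳ (λ T → total (λ ℓ → prod (deviation ℓ) T) hs)) (𝔼-const Pʳ (M * excess)))))))
      (ℚP.+-mono-≤ (ℚP.+-monoʳ-≤ (M * excess) (𝔼-total-≤ Pʳ (λ ℓ → prod (deviation ℓ))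
          (λ ℓ → ℚP.≤-trans (ℚP.≤-reflexive (𝔼-prod (iid P s) (deviation ℓ) r))
            (^ℚ-mono (𝔼-≥ (iid P s) (deviation-≥0 ℓ)) (𝔼-deviation ℓ) r)) hs))
        (ℚP.≤-trans (ℚP.≤-reflexive (𝔼-total (iid P s) (deviation ℓ*) r))
          (*-monoˡ (ℕ→ℚ r) (0≤ℕ→ℚ r) (𝔼-deviation ℓ*))))
      where
      Pʳ = iid (iid P s) r

    𝔼-success-≥ : (good : ℚ → Bool) → (∀ x → Δ - ε ≤ x → x ≤ Δ + ε → good x ≡ true) →
      1ℚ - ((M * excess + ℕ→ℚ q * κ ^ℚ r) + ℕ→ℚ r * κ) ≤ 𝔼 (iid (iid P s) r) (λ T → 𝟙 (good (est T)))
    𝔼-success-≥ good good-true = ℚP.≤-trans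
      (ℚP.+-monoʳ-≤ 1ℚ (ℚP.neg-antimono-≤ 𝔼-penalty))
      (ℚP.≤-trans (ℚP.≤-reflexive (sym (trans (𝔼-- Pʳ (λ _ → 1ℚ) penalty) (cong (_- 𝔼 Pʳ penalty) (𝔼-const Pʳ 1ℚ)))))
        (𝔼-mono Pʳ (success-≥ good good-true)))
      where
      Pʳ = iid (iid P s) r

-- Edit distance, cluster graphs and labellings

sum-tabulate : ∀ {n} {A : Set} (g : A → ℕ) (h : Fin n → A) →
  ℕ→ℚ (sum (List.map g (List.tabulate h))) ≡ sumFin (λ v → ℕ→ℚ (g (h v)))
sum-tabulate {zero} g h = refl
sum-tabulate {suc n} g h = trans (ℕ→ℚ-+ (g (h zero)) (sum (List.map g (List.tabulate (h ∘ suc)))))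
  (cong (ℕ→ℚ (g (h zero)) +_) (sum-tabulate g (h ∘ suc)))

<ᵇ⇒≢ᵇ : ∀ a b → (a ℕ.<ᵇ b) ≡ true → (a ℕ.≡ᵇ b) ≡ false
<ᵇ⇒≢ᵇ zero (suc b) e = refl
<ᵇ⇒≢ᵇ (suc a) (suc b) e = <ᵇ⇒≢ᵇ a b e

graphLoss : ∀ {n} → AdjMatrix n → AdjMatrix n → Fin n → Fin n → ℚ
graphLoss G G′ u v = 𝟙 (toℕ u ℕ.<ᵇ toℕ v) * mismatch (G u v) (G′ u v)

graphLoss-≥0 : ∀ {n} (G G′ : AdjMatrix n) u v → 0ℚ ≤ graphLoss G G′ u v
graphLoss-≥0 G G′ u v = 0≤-* (𝟙-≥0 (toℕ u ℕ.<ᵇ toℕ v)) (mismatch-≥0 (G u v) (G′ u v))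

graphLoss-≤1 : ∀ {n} (G G′ : AdjMatrix n) u v → graphLoss G G′ u v ≤ 1ℚ
graphLoss-≤1 G G′ u v = ℚP.≤-trans (*-mono (𝟙-≥0 (toℕ u ℕ.<ᵇ toℕ v)) 0≤1 (𝟙-≤1 (toℕ u ℕ.<ᵇ toℕ v)) (mismatch-≤1 (G u v) (G′ u v)))
  (ℚP.≤-reflexive (ℚP.*-identityˡ 1ℚ))

graphLoss-cong : ∀ {n} (G G′ G″ : AdjMatrix n) → (∀ u v → (toℕ u ℕ.<ᵇ toℕ v) ≡ true → G′ u v ≡ G″ u v) →
  ∀ u v → graphLoss G G′ u v ≡ graphLoss G G″ u v
graphLoss-cong G G′ G″ eq u v with toℕ u ℕ.<ᵇ toℕ v in e
... | true = cong (λ b → 1ℚ * mismatch (G u v) b) (eq u v e)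
... | false = trans (ℚP.*-zeroˡ (mismatch (G u v) (G′ u v))) (sym (ℚP.*-zeroˡ (mismatch (G u v) (G″ u v))))

diffCount-sum : ∀ {n} (G G′ : AdjMatrix n) → ℕ→ℚ (diffCount G G′) ≡ sumFin (λ u → sumFin (graphLoss G G′ u))
diffCount-sum {n} G G′ = trans (sum-tabulate {n} (λ u → sum (List.map (entry u) (List.allFin n))) id)
  (sumFin-cong {n} (λ u → trans (sum-tabulate {n} (entry u) id) (sumFin-cong {n} (pointwise u))))
  where
  entry : Fin n → Fin n → ℕ
  entry u v = if does (toℕ u ℕ.<? toℕ v) then (if does (G u v ≟B G′ u v) then 0 else 1) else 0
  pointwise : ∀ u v → ℕ→ℚ (entry u v) ≡ graphLoss G G′ u v
  pointwise u v with toℕ u ℕ.<ᵇ toℕ v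
  ... | false = sym (ℚP.*-zeroˡ (mismatch (G u v) (G′ u v)))
  ... | true with does (G u v ≟B G′ u v)
  ...   | true = refl
  ...   | false = refl

module _ {n : ℕ} where
  private
    A = Fin (suc n)
    U = uniform (suc n)
    r² = recip (suc n) * recip (suc n)

  pairs-uniform : ∀ (f : A → A → ℚ) → 𝔼 U (λ u → 𝔼 U (f u)) ≡ r² * sumFin (λ u → sumFin (f u))
  pairs-uniform f = trans (cong (recip (suc n) *_) (sumFin-* (recip (suc n)) (λ u → sumFin (f u))))
    (sym (ℚP.*-assoc (recip (suc n)) (recip (suc n)) (sumFin (λ u → sumFin (f u)))))

  density : ℕ → ℚ
  density d = r² * ℕ→ℚ d

  0≤r² : 0ℚ ≤ r²
  0≤r² = 0≤-* (0≤recip (suc n)) (0≤recip (suc n))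

  graphLoss-density : ∀ (G G′ : AdjMatrix (suc n)) → 𝔼 U (λ u → 𝔼 U (graphLoss G G′ u)) ≡ density (diffCount G G′)
  graphLoss-density G G′ = trans (pairs-uniform (graphLoss G G′)) (cong (r² *_) (sym (diffCount-sum G G′)))

  module _ {k : ℕ} (x : A → Fin (suc k)) where

    clusterGraph : AdjMatrix (suc n)
    clusterGraph u v = if toℕ u ℕ.≡ᵇ toℕ v then false else same (x u) (x v)

    clusterGraph-same : ∀ u v → clusterGraph u v ≡ true → same (x u) (x v) ≡ true
    clusterGraph-same u v e with toℕ u ℕ.≡ᵇ toℕ v
    ... | false = e

    clusterGraph-simple : IsSimpleGraph clusterGraph
    clusterGraph-simple = symmetric , λ u → cong (λ b → if b then false else same (x u) (x u)) (≡ᵇ-refl (toℕ u))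
      where
      symmetric : ∀ u v → clusterGraph u v ≡ clusterGraph v u
      symmetric u v with toℕ u ℕ.≡ᵇ toℕ v in e | toℕ v ℕ.≡ᵇ toℕ u in e′
      ... | true | true = refl
      ... | false | false = same-sym (x u) (x v)
      ... | true | false = ⊥-elim (≡ᵇ-false (toℕ v) (toℕ u) e′ (sym (≡ᵇ-true (toℕ u) (toℕ v) e)))
      ... | false | true = ⊥-elim (≡ᵇ-false (toℕ u) (toℕ v) e (sym (≡ᵇ-true (toℕ v) (toℕ u) e′)))

    clusterGraph-P3Free : InducedP3Free clusterGraph
    clusterGraph-P3Free u v w u≢v v≢w u≢w uv vw with toℕ u ℕ.≡ᵇ toℕ w in e
    ... | true = ⊥-elim (u≢w (FinP.toℕ-injective (≡ᵇ-true (toℕ u) (toℕ w) e)))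
    ... | false with same-true (x u) (x v) (clusterGraph-same u v uv) | same-true (x v) (x w) (clusterGraph-same v w vw)
    ...   | l , xu≡ , xv≡ | l′ , xv≡′ , xw≡ =
      trans (cong₂ same (trans xu≡ (trans (sym xv≡) xv≡′)) xw≡) (same-suc l′)

    pairLoss≡graphLoss : ∀ (G : AdjMatrix (suc n)) u v → pairLoss G u v (x u) (x v) ≡ graphLoss G clusterGraph u v
    pairLoss≡graphLoss G = graphLoss-cong G (λ u v → same (x u) (x v)) clusterGraph
      (λ u v e → sym (cong (λ b → if b then false else same (x u) (x v)) (<ᵇ⇒≢ᵇ (toℕ u) (toℕ v) e)))

    labelling-≥ : ∀ {G d} → IsDistP3Free G d → density d ≤ 𝔼 U (λ u → 𝔼 U (λ v → pairLoss G u v (x u) (x v)))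
    labelling-≥ {G} {d} (_ , minimal) = subst (density d ≤_)
      (sym (trans (𝔼-cong U (λ u → 𝔼-cong U (pairLoss≡graphLoss G u))) (graphLoss-density G clusterGraph)))
      (*-monoˡ r² 0≤r² (ℕ→ℚ-mono (minimal clusterGraph clusterGraph-simple clusterGraph-P3Free)))

  module _ (G′ : AdjMatrix (suc n)) (simple : IsSimpleGraph G′) (P3Free : InducedP3Free G′) where

    -- The reflexive closure of `G′`. Absence of induced paths on three vertices is transitivity for
    -- distinct vertices, so the closure is an equivalence relation.
    cluster : A → A → Bool
    cluster u v = if toℕ u ℕ.≡ᵇ toℕ v then true else G′ u v

    private
      cluster⇒ : ∀ u v → cluster u v ≡ true → u ≡ v ⊎ G′ u v ≡ true
      cluster⇒ u v e with toℕ u ℕ.≡ᵇ toℕ v in e′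
      ... | true = inj₁ (FinP.toℕ-injective (≡ᵇ-true (toℕ u) (toℕ v) e′))
      ... | false = inj₂ e

      ⇒cluster : ∀ u v → G′ u v ≡ true → cluster u v ≡ true
      ⇒cluster u v e with toℕ u ℕ.≡ᵇ toℕ v
      ... | true = refl
      ... | false = e

      cluster-refl : ∀ u → cluster u u ≡ true
      cluster-refl u = cong (λ b → if b then true else G′ u u) (≡ᵇ-refl (toℕ u))

      ⇔⇒≡ : ∀ a b → (a ≡ true → b ≡ true) → (b ≡ true → a ≡ true) → a ≡ b
      ⇔⇒≡ true b f g = sym (f refl)
      ⇔⇒≡ false true f g = g refl
      ⇔⇒≡ false false f g = refl

      cluster-sym-true : ∀ u v → cluster u v ≡ true → cluster v u ≡ true
      cluster-sym-true u v e with cluster⇒ u v e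
      ... | inj₁ refl = cluster-refl u
      ... | inj₂ e′ = ⇒cluster v u (trans (proj₁ simple v u) e′)

      cluster-trans-true : ∀ u v w → cluster u v ≡ true → cluster v w ≡ true → cluster u w ≡ true
      cluster-trans-true u v w uv vw with cluster⇒ u v uv | cluster⇒ v w vw | u FinP.≟ w
      ... | inj₁ refl | _ | _ = vw
      ... | inj₂ _ | inj₁ refl | _ = uv
      ... | inj₂ _ | inj₂ _ | yes refl = cluster-refl u
      ... | inj₂ uv′ | inj₂ vw′ | no u≢w =
        ⇒cluster u w (P3Free u v w (distinct u v uv′) (distinct v w vw′) u≢w uv′ vw′)
        where
        distinct : ∀ u v → G′ u v ≡ true → u ≢ v
        distinct u v e refl = true≢false (trans (sym e) (proj₂ simple u))

    cluster-sym : ∀ u v → cluster u v ≡ cluster v u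
    cluster-sym u v = ⇔⇒≡ (cluster u v) (cluster v u) (cluster-sym-true u v) (cluster-sym-true v u)

    cluster-trans : ∀ u v → cluster u v ≡ true → ∀ w → cluster u w ≡ cluster v w
    cluster-trans u v uv w = ⇔⇒≡ (cluster u w) (cluster v w)
      (cluster-trans-true v u w (cluster-sym-true u v uv)) (cluster-trans-true u v w uv)

    cluster-loss : ∀ (G : AdjMatrix (suc n)) u v → graphLoss G cluster u v ≡ graphLoss G G′ u v
    cluster-loss G = graphLoss-cong G cluster G′
      (λ u v e → cong (λ b → if b then true else G′ u v) (<ᵇ⇒≢ᵇ (toℕ u) (toℕ v) e))

  -- The representatives have to be chosen for `W`, while the distance is an average under the
  -- uniform law; the change of law for an optimal graph costs the term `2ℚ * δ`.
  good-labelling : ∀ {G d} → IsDistP3Free G d → ∀ (W : Expectation A) → Fubini W → ∀ {δ} → Near W U δ →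
    ∀ k .{{_ : ℕ.NonZero k}} → Σ (A → Fin (suc k)) λ x →
      𝔼 W (λ u → 𝔼 W (λ v → pairLoss G u v (x u) (x v))) ≤ density d + 2ℚ * δ + recip k
  good-labelling {G} {d} ((G′ , simple , P3Free , refl) , _) W fubini {δ} W≈U k = proj₁ few ,
    ℚP.≤-trans (proj₂ few) (ℚP.+-monoˡ-≤ (recip k) (ℚP.≤-trans
      (ℚP.≤-reflexive (𝔼-cong W (λ u → 𝔼-cong W (cluster-loss G′ simple P3Free G u))))
      (ℚP.≤-trans (near-pairs W≈U (graphLoss G G′) (graphLoss-≥0 G G′) (graphLoss-≤1 G G′))
        (ℚP.≤-reflexive (cong (_+ 2ℚ * δ) (graphLoss-density G G′))))))
    where
    few = few-labels W fubini (cluster G′ simple P3Free) (cluster-sym G′ simple P3Free)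
            (cluster-trans G′ simple P3Free) k G

  density-≤1 : ∀ {G : AdjMatrix (suc n)} {d} → IsDistP3Free G d → density d ≤ 1ℚ
  density-≤1 {G} ((G′ , _ , _ , refl) , _) = subst (_≤ 1ℚ) (graphLoss-density G G′)
    (𝔼-≤ U (λ u → 𝔼-≤ U (graphLoss-≤1 G G′ u)))

accurate-true : ∀ n d ε x → density {n} d - ε ≤ x → x ≤ density {n} d + ε → accurate (suc n) d ε x ≡ true
accurate-true n d ε x ≥Δ-ε ≤Δ+ε = T⇒true (ℚP.≤⇒≤ᵇ (abs-≤ upper lower))
  where
  T⇒true : ∀ {b} → T b → b ≡ true
  T⇒true {true} _ = refl
  abs-≤ : ∀ {y c} → y ≤ c → - y ≤ c → ∣ y ∣ ≤ c
  abs-≤ {y} {c} y≤c -y≤c with ℚP.∣p∣≡p∨∣p∣≡-p y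
  ... | inj₁ e = subst (_≤ c) (sym e) y≤c
  ... | inj₂ e = subst (_≤ c) (sym e) -y≤c
  n² = ℕ→ℚ (suc n ℕ.* suc n)
  r = recip (suc n)
  0≤n² : 0ℚ ≤ n²
  0≤n² = 0≤ℕ→ℚ (suc n ℕ.* suc n)
  d≡ : ℕ→ℚ d ≡ density {n} d * n²
  d≡ = trans (sym (ℚP.*-identityˡ (ℕ→ℚ d))) (trans (cong (_* ℕ→ℚ d) (sym (trans
      (cong₂ _*_ (ℕ→ℚ*recip (suc n)) (ℕ→ℚ*recip (suc n))) (ℚP.*-identityˡ 1ℚ))))
    (trans (lemma (ℕ→ℚ (suc n)) r (ℕ→ℚ d)) (cong (density {n} d *_) (sym (ℕ→ℚ-* (suc n) (suc n))))))
    where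
    lemma : ∀ n r d → ((n * r) * (n * r)) * d ≡ ((r * r) * d) * (n * n)
    lemma = solve-∀ ℚ-ring
  upper : x * n² - ℕ→ℚ d ≤ ε * n²
  upper = subst (λ z → x * n² - z ≤ ε * n²) (sym d≡)
    (≤-by _ (0≤-* (≤⇒0≤- ≤Δ+ε) 0≤n²) (lemma x n² (density {n} d) ε))
    where
    lemma : ∀ x n D e → e * n ≡ x * n - D * n + (D + e - x) * n
    lemma = solve-∀ ℚ-ring
  lower : - (x * n² - ℕ→ℚ d) ≤ ε * n²
  lower = subst (λ z → - (x * n² - z) ≤ ε * n²) (sym d≡)
    (≤-by _ (0≤-* (≤⇒0≤- ≥Δ-ε) 0≤n²) (lemma x n² (density {n} d) ε))
    where
    lemma : ∀ x n D e → e * n ≡ - (x * n - D * n) + (x - (D - e)) * n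
    lemma = solve-∀ ℚ-ring

total-map : ∀ {A B : Set} {t} (f : B → ℚ) (g : A → B) (xs : Vec A t) → total f (Vec.map g xs) ≡ total (f ∘ g) xs
total-map f g [] = refl
total-map f g (x ∷ xs) = cong (f (g x) +_) (total-map f g xs)

maxOver-mean-map : ∀ {A B : Set} {s r} (f : B → ℚ) (g : A → B) (T : Vec (Vec A s) r) →
  maxOver (mean f) (Vec.map (Vec.map g) T) ≡ maxOver (mean (f ∘ g)) T
maxOver-mean-map f g [] = refl
maxOver-mean-map {s = s} f g (D ∷ T) = cong₂ _⊔_ (cong (recip s *_) (total-map f g D)) (maxOver-mean-map f g T)

minOver-cong : ∀ {A : Set} {t} {f g : A → ℚ} → (∀ a → f a ≡ g a) → (xs : Vec A t) → minOver f xs ≡ minOver g xs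
minOver-cong f≗g [] = refl
minOver-cong f≗g (x ∷ xs) = cong₂ _⊓_ (f≗g x) (minOver-cong f≗g xs)

-- Success probability for general sample sizes

module Correctness (n w′ N t r s : ℕ) {{_ : ℕ.NonZero t}} {{_ : ℕ.NonZero s}}
  (nw≤ : suc n ℕ.* suc w′ ℕ.≤ 2 ℕ.^ N)
  (G : AdjMatrix (suc n)) (simple : IsSimpleGraph G) (d : ℕ) (dist : IsDistP3Free G d)
  where

  private
    w = suc w′
    δ = recip w
    V = Fin (suc n)
    W = drawn {n} N 0
    U = uniform (suc n)
    block = proj₁ (balanced-blocks w′ (suc n))
    bl : V → ℕ
    bl = toℕ ∘ block
    module 𝔸 = Algo n bl N w w t r s
    U≈W : Near U W δ
    U≈W = uniform-near-drawn N w nw≤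
    W≈U : Near W U δ
    W≈U = near-sym U≈W
    Δ = density {n} d
    start = good-labelling {G = G} dist W (drawn-fubini N 0) W≈U w
    x₀ = proj₁ start
    before : V → V → ℚ
    before u v = 𝟙 (toℕ u ℕ.<ᵇ toℕ v)
    pick : Vec V t → Vec 𝔸.Lab t → V → 𝔸.Lab
    pick S ℓ v = 𝔸.choose ℓ S v (Vec.map (G v) S)
    module ℝ = Rounds W (drawn-fubini N 0) w (pairLoss G) before (pairLoss-≥0 G) (pairLoss-≤ G) bl t pick

    rows : ∀ {m} → V → Vec (Vec V t) m → Vec (Vec Bool t) m
    rows v Ss = Vec.map (Vec.map (G v)) Ss

    label≡hypLabel : ∀ {m} b c v (ℓs : Vec (Vec 𝔸.Lab t) m) Ss → ℝ.label b c v ℓs Ss ≡ 𝔸.hypLabel b c v ℓs Ss (rows v Ss)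
    label≡hypLabel b c v [] [] = refl
    label≡hypLabel b c v (ℓ ∷ ℓs) (S ∷ Ss) = label≡hypLabel (suc b) (if bl v ℕ.≡ᵇ b then pick S ℓ v else c) v ℓs Ss

    total-empirical : ∀ {t} (S : Vec V t) (x : V → 𝔸.Lab) v c →
      total (λ u → pairLoss G u v (x u) c + pairLoss G v u c (x u)) S ≡ 𝔸.empiricalLoss v c (Vec.map x S) S (Vec.map (G v) S)
    total-empirical [] x v c = refl
    total-empirical (u ∷ S) x v c = cong₂ _+_
      -- The algorithm asks for `G v u` whereas this loss reads `G u v`; symmetry of the graph
      -- reconciles them.
      (cong (λ g → 𝟙 (toℕ u ℕ.<ᵇ toℕ v) * mismatch g (same (x u) c) + pairLoss G v u c (x u)) (proj₁ simple u v))
      (total-empirical S x v c)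

    pick-min : ∀ S x v c → total (λ u → ℝ.σ u v (x u) (pick S (Vec.map x S) v)) S ≤ total (λ u → ℝ.σ u v (x u) c) S
    pick-min S x v c = ℚP.≤-trans (ℚP.≤-reflexive (total-empirical S x v (pick S (Vec.map x S) v)))
      (ℚP.≤-trans (argmin-≤ (λ c → 𝔸.empiricalLoss v c (Vec.map x S) S (Vec.map (G v) S)) c)
        (ℚP.≤-reflexive (sym (total-empirical S x v c))))

    datum : 𝔸.Samples → V × V → 𝔸.Datum
    datum Ss p = answer (𝔸.datumProbe Ss p) G

    loss : 𝔸.Samples → 𝔸.Hyp → V × V → ℚ
    loss Ss ℓs p = 𝔸.hypLoss Ss ℓs (datum Ss p)

    hypOf : 𝔸.Samples → 𝔸.Hyp → V → 𝔸.Lab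
    hypOf Ss ℓs v = 𝔸.hypLabel 0 zero v ℓs Ss (rows v Ss)

    -- The labels produced by the relabelling process from the near-optimal `x₀`. The algorithm
    -- cannot compute them, but they occur among its hypotheses.
    ℓ* : 𝔸.Samples → 𝔸.Hyp
    ℓ* Ss = ℝ.sampleLabels 0 x₀ Ss

    ℓ*∈ : ∀ Ss → ℓ* Ss ∈ 𝔸.hyps
    ℓ*∈ Ss = ∈-allVecs (∈-allVecs VecM.∈-allFin⁺) (ℓ* Ss)

    run≡hypOf : ∀ Ss v → ℝ.run 0 x₀ Ss v ≡ hypOf Ss (ℓ* Ss) v
    run≡hypOf Ss v = trans (ℝ.run≡label 0 x₀ Ss v)
      -- There are as many rounds as blocks, so the unknown start `x₀ v` may be replaced by the
      -- label `zero` that the algorithm starts with.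
      (trans (ℝ.label-start 0 (x₀ v) zero v (ℓ* Ss) Ss ℕ.z≤n (FinP.toℕ<n (block v)))
             (label≡hypLabel 0 zero v (ℓ* Ss) Ss))

    risk* : ∀ Ss → 𝔼 (W ⊗ W) (loss Ss (ℓ* Ss)) ≡ ℝ.cost (ℝ.run 0 x₀ Ss)
    risk* Ss = 𝔼-cong W (λ u → 𝔼-cong W (λ v → sym (cong₂ (pairLoss G u v) (run≡hypOf Ss u) (run≡hypOf Ss v))))

    risk-≥ : ∀ Ss ℓs → Δ - 2ℚ * δ ≤ 𝔼 (W ⊗ W) (loss Ss ℓs)
    risk-≥ Ss ℓs = 0≤-⇒≤ (subst (0ℚ ≤_) (lemma (𝔼 (W ⊗ W) (loss Ss ℓs)) Δ (2ℚ * δ)) (≤⇒0≤- (ℚP.≤-trans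
      (labelling-≥ (hypOf Ss ℓs) {G} dist)
      (near-pairs U≈W (λ u v → pairLoss G u v (hypOf Ss ℓs u) (hypOf Ss ℓs v))
        (λ u v → pairLoss-≥0 G u v (hypOf Ss ℓs u) (hypOf Ss ℓs v)) (λ u v → pairLoss-≤1 G u v (hypOf Ss ℓs u) (hypOf Ss ℓs v))))))
      where
      lemma : ∀ r D s → r + s - D ≡ r - (D - s)
      lemma = solve-∀ ℚ-ring

    same-block-pairs : ℝ.pairs (λ u v → before u v * ℝ.sameBlock u v) ≤ δ + 2ℚ * δ
    same-block-pairs = ℚP.≤-trans
      (near-pairs W≈U f (λ u v → 0≤-* (𝟙-≥0 (toℕ u ℕ.<ᵇ toℕ v)) (𝟙-≥0 (bl u ℕ.≡ᵇ bl v)))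
        (λ u v → ℚP.≤-trans (*-mono (𝟙-≥0 (toℕ u ℕ.<ᵇ toℕ v)) 0≤1 (𝟙-≤1 (toℕ u ℕ.<ᵇ toℕ v)) (𝟙-≤1 (bl u ℕ.≡ᵇ bl v)))
          (ℚP.≤-reflexive (ℚP.*-identityˡ 1ℚ))))
      (ℚP.+-monoˡ-≤ (2ℚ * δ) (ℚP.≤-trans (ℚP.≤-reflexive (pairs-uniform f))
        (ℚP.≤-trans (*-monoˡ (R * R) (0≤r² {n}) (proj₂ (balanced-blocks w′ (suc n))))
          (ℚP.≤-reflexive (trans (lemma R δ (ℕ→ℚ (suc n))) (trans (cong (λ z → (z * z) * δ) (ℕ→ℚ*recip (suc n)))
            (trans (cong (_* δ) (ℚP.*-identityˡ 1ℚ)) (ℚP.*-identityˡ δ))))))))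
      where
      R = recip (suc n)
      f : V → V → ℚ
      f u v = before u v * 𝟙 (bl u ℕ.≡ᵇ bl v)
      lemma : ∀ r δ n → (r * r) * (δ * (n * n)) ≡ ((n * r) * (n * r)) * δ
      lemma = solve-∀ ℚ-ring

  module _ (η M′ : ℚ) (0≤η : 0ℚ ≤ η) (0≤M′ : 0ℚ ≤ M′) (M′η≡1 : M′ * η ≡ 1ℚ)
    (M γ ε : ℚ) (0≤M : 0ℚ ≤ M) (Mγ≡1 : M * γ ≡ 1ℚ) (0≤γ : 0ℚ ≤ γ) (γ+γ≤ε : γ + γ ≤ ε) (2δ≤γ : 2ℚ * δ ≤ γ)
    where
    private
      module Aℝ = ℝ.Analysis (pairLoss-sym-≤1 G) pick-min η M′ 0≤η 0≤M′ M′η≡1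

      0≤ε : 0ℚ ≤ ε
      0≤ε = ℚP.≤-trans (0≤-+ 0≤γ 0≤γ) γ+γ≤ε

      module 𝕄 (Ss : 𝔸.Samples) = MinMax (W ⊗ W) 𝔸.hyps (loss Ss)
        (λ ℓs (u , v) → pairLoss-≥0 G u v (hypOf Ss ℓs u) (hypOf Ss ℓs v))
        (λ ℓs (u , v) → pairLoss-≤1 G u v (hypOf Ss ℓs u) (hypOf Ss ℓs v))
        s r M γ 0≤M Mγ≡1

      -- The error budget `ε` is split into two halves: `γ` is both the threshold for the risk of
      -- `ℓ*` and the tolerated deviation of a batch mean.
      module 𝔼rr (Ss : 𝔸.Samples) = 𝕄.Error Ss 0≤γ (ℓ* Ss) (ℓ*∈ Ss) Δ ε γ M (2ℚ * δ) 0≤ε 0≤M Mγ≡1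
        (0≤-* (0≤r² {n}) (0≤ℕ→ℚ d)) (density-≤1 {n} {G} dist) (0≤-* 0≤2 (0≤recip w)) γ+γ≤ε
        (ℚP.≤-trans (ℚP.+-monoˡ-≤ γ 2δ≤γ) γ+γ≤ε) (risk-≥ Ss)

      good = accurate (suc n) d ε

      estimate≡est : ∀ Ss T → 𝔸.estimate Ss (Vec.map (Vec.map (datum Ss)) T) ≡ 𝕄.est Ss T
      estimate≡est Ss T = minOver-cong (λ ℓs → maxOver-mean-map (𝔸.hypLoss Ss ℓs) (datum Ss) T) 𝔸.hyps

      Wˢ = iid (iid W t) w

      Q = ℕ→ℚ ((suc w ℕ.^ t) ℕ.^ w)
      κ = (M * M) * recip s

    ρ : ℚ
    ρ = η + M′ * (ℕ→ℚ (suc w) * recip t)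

    private
      -- The constant collects `2 + 1` for the starting labelling (change of law and few labels),
      -- `2 * (1 + 2)` for pairs inside blocks, and `2` for the slack.
      𝔼-excess : 𝔼 Wˢ 𝔼rr.excess ≤ ℕ→ℚ 11 * δ + ℕ→ℚ w * ρ
      𝔼-excess = ℚP.≤-trans (ℚP.≤-reflexive (trans (𝔼-+const Wˢ (λ Ss → 𝕄.risk Ss (ℓ* Ss) - Δ) (2ℚ * δ))
          (cong (_+ 2ℚ * δ) (trans (𝔼-+const Wˢ (λ Ss → 𝕄.risk Ss (ℓ* Ss)) (- Δ)) (cong (_- Δ) (𝔼-cong Wˢ risk*))))))
        (ℚP.≤-trans (ℚP.+-monoˡ-≤ (2ℚ * δ) (ℚP.+-monoˡ-≤ (- Δ)
            (ℚP.≤-trans (Aℝ.run-≤ (λ u v → 𝟙-≥0 (toℕ u ℕ.<ᵇ toℕ v)) w x₀)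
              (ℚP.+-mono-≤ (ℚP.+-monoˡ-≤ (ℕ→ℚ w * ρ) (proj₂ start)) (*-monoˡ 2ℚ 0≤2 same-block-pairs)))))
          (ℚP.≤-reflexive (lemma Δ δ (ℕ→ℚ w * ρ))))
        where
        lemma : ∀ D δ x → D + 2ℚ * δ + δ + x + 2ℚ * (δ + 2ℚ * δ) - D + 2ℚ * δ ≡ ℕ→ℚ 11 * δ + x
        lemma = solve-∀ ℚ-ring

    tree-success-≥ : 1ℚ - ((M * (ℕ→ℚ 11 * δ + ℕ→ℚ w * ρ) + Q * κ ^ℚ r) + ℕ→ℚ r * κ) ≤ successProb 𝔸.tree G good
    tree-success-≥ = ℚP.≤-trans (≤-by _ (0≤-* 0≤M (≤⇒0≤- 𝔼-excess))
        (lemma M (𝔼 Wˢ 𝔼rr.excess) (ℕ→ℚ 11 * δ + ℕ→ℚ w * ρ) (Q * κ ^ℚ r) (ℕ→ℚ r * κ)))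
      (ℚP.≤-trans (ℚP.≤-reflexive (sym linear))
        (ℚP.≤-trans (𝔼-mono Wˢ (λ Ss → ℚP.≤-trans
            (𝔼rr.𝔼-success-≥ Ss good (accurate-true n d ε))
            (ℚP.≤-reflexive (𝔼-cong (iid (iid (W ⊗ W) s) r) (λ T → cong (𝟙 ∘ good) (sym (estimate≡est Ss T)))))))
          (ℚP.≤-reflexive (sym (𝔸.tree-success G good)))))
      where
      lemma : ∀ m x y a b → 1ℚ - ((m * x + a) + b) ≡ 1ℚ - ((m * y + a) + b) + m * (y - x)
      lemma = solve-∀ ℚ-ring
      rest = Q * κ ^ℚ r
      linear : 𝔼 Wˢ (λ Ss → 1ℚ - ((M * 𝔼rr.excess Ss + rest) + ℕ→ℚ r * κ))
        ≡ 1ℚ - ((M * 𝔼 Wˢ 𝔼rr.excess + rest) + ℕ→ℚ r * κ)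
      linear = trans (𝔼-- Wˢ (λ _ → 1ℚ) (λ Ss → (M * 𝔼rr.excess Ss + rest) + ℕ→ℚ r * κ)) (cong₂ _-_ (𝔼-const Wˢ 1ℚ)
        (trans (𝔼-+const Wˢ (λ Ss → M * 𝔼rr.excess Ss + rest) (ℕ→ℚ r * κ)) (cong (_+ ℕ→ℚ r * κ)
          (trans (𝔼-+const Wˢ (λ Ss → M * 𝔼rr.excess Ss) rest) (cong (_+ rest) (𝔼-* Wˢ M 𝔼rr.excess))))))

-- Parameters

abstract
  -- Abstract, because unfolding (suc m) ^ 11 during conversion checking is exponentially expensive.
  pow : ℕ → ℕ → ℕ
  pow = ℕ._^_

  pow-zero : ∀ a → pow a zero ≡ 1
  pow-zero a = refl

  pow-suc : ∀ a j → pow a (suc j) ≡ a ℕ.* pow a j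
  pow-suc a j = refl

  pow-+ : ∀ a i j → pow a (i ℕ.+ j) ≡ pow a i ℕ.* pow a j
  pow-+ = ℕP.^-distribˡ-+-*

  pow>0 : ∀ a j .{{_ : ℕ.NonZero a}} → 0 ℕ.< pow a j
  pow>0 a j = ℕP.m^n>0 a j

pow≢0 : ∀ a j .{{_ : ℕ.NonZero a}} → ℕ.NonZero (pow a j)
pow≢0 a j = ℕ.>-nonZero (pow>0 a j)

ℕ→ℚ-pow : ∀ a j → ℕ→ℚ (pow a j) ≡ ℕ→ℚ a ^ℚ j
ℕ→ℚ-pow a zero = cong ℕ→ℚ (pow-zero a)
ℕ→ℚ-pow a (suc j) = trans (cong ℕ→ℚ (pow-suc a j))
  (trans (ℕ→ℚ-* a (pow a j)) (cong (ℕ→ℚ a *_) (ℕ→ℚ-pow a j)))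

ℕ→ℚ-^ : ∀ a j → ℕ→ℚ (a ℕ.^ j) ≡ ℕ→ℚ a ^ℚ j
ℕ→ℚ-^ a zero = refl
ℕ→ℚ-^ a (suc j) = trans (ℕ→ℚ-* a (a ℕ.^ j)) (cong (ℕ→ℚ a *_) (ℕ→ℚ-^ a j))

^ℚ-distrib-* : ∀ p q j → (p * q) ^ℚ j ≡ p ^ℚ j * q ^ℚ j
^ℚ-distrib-* p q zero = sym (ℚP.*-identityˡ 1ℚ)
^ℚ-distrib-* p q (suc j) = trans (cong ((p * q) *_) (^ℚ-distrib-* p q j)) (lemma p q (p ^ℚ j) (q ^ℚ j))
  where
  lemma : ∀ p q x y → p * q * (x * y) ≡ p * x * (q * y)
  lemma = solve-∀ ℚ-ring

recip-unique : ∀ k .{{_ : ℕ.NonZero k}} {y} → ℕ→ℚ k * y ≡ 1ℚ → recip k ≡ y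
recip-unique k {y} ky≡1 = trans (sym (ℚP.*-identityʳ (recip k))) (trans (cong (recip k *_) (sym ky≡1))
  (trans (lemma (recip k) (ℕ→ℚ k) y) (trans (cong (_* y) (ℕ→ℚ*recip k)) (ℚP.*-identityˡ y))))
  where
  lemma : ∀ r k y → r * (k * y) ≡ k * r * y
  lemma = solve-∀ ℚ-ring

1^ℚ : ∀ j → 1ℚ ^ℚ j ≡ 1ℚ
1^ℚ zero = refl
1^ℚ (suc j) = trans (ℚP.*-identityˡ (1ℚ ^ℚ j)) (1^ℚ j)

recip-pow : ∀ k j .{{_ : ℕ.NonZero k}} → recip (pow k j) ≡ recip k ^ℚ j
recip-pow k j = recip-unique (pow k j) {{pow≢0 k j}} (trans (cong (_* recip k ^ℚ j) (ℕ→ℚ-pow k j))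
  (trans (sym (^ℚ-distrib-* (ℕ→ℚ k) (recip k) j)) (trans (cong (_^ℚ j) (ℕ→ℚ*recip k)) (1^ℚ j))))

n≤2^n : ∀ n → n ℕ.≤ 2 ℕ.^ n
n≤2^n zero = ℕ.z≤n
n≤2^n (suc n) = ℕP.+-mono-≤ (ℕP.m^n>0 2 n) (ℕP.≤-trans (n≤2^n n) (ℕP.≤-reflexive (sym (ℕP.+-identityʳ (2 ℕ.^ n)))))

-- ⌊1/ε⌋ + 1 for positive ε, written on the numerator and the denominator.
precision : ℚ → ℕ
precision (mkℚ (pos (suc a)) b _) = suc (suc b DivMod./ suc a)
precision _ = 1

precision-nonZero : ∀ ε → ℕ.NonZero (precision ε)
precision-nonZero (mkℚ (pos (suc a)) b _) = _
precision-nonZero (mkℚ (pos zero) b _) = _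
precision-nonZero (mkℚ (ℤ.-[1+ a ]) b _) = _

ε*denominator : ∀ a b .(c : Coprime a (suc b)) → mkℚ (pos a) b c * ℕ→ℚ (suc b) ≡ ℕ→ℚ a
ε*denominator a b c = ℚP.toℚᵘ-injective (begin
  ℚ.toℚᵘ (mkℚ (pos a) b c * ℕ→ℚ (suc b))
    ≈⟨ ℚP.toℚᵘ-homo-* (mkℚ (pos a) b c) (ℕ→ℚ (suc b)) ⟩
  ℚᵘ.mkℚᵘ (pos a) b ℚᵘ.* ℚ.toℚᵘ (ℕ→ℚ (suc b))
    ≈⟨ ℚᵘP.*-congˡ {ℚᵘ.mkℚᵘ (pos a) b} (ℚP.toℚᵘ-fromℚᵘ (ℚᵘ.mkℚᵘ (pos (suc b)) 0)) ⟩
  ℚᵘ.mkℚᵘ (pos a) b ℚᵘ.* ℚᵘ.mkℚᵘ (pos (suc b)) 0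
    ≈⟨ ℚᵘ.*≡* eq ⟩
  ℚᵘ.mkℚᵘ (pos a) 0
    ≈⟨ ℚP.toℚᵘ-fromℚᵘ (ℚᵘ.mkℚᵘ (pos a) 0) ⟨
  ℚ.toℚᵘ (ℕ→ℚ a) ∎)
  where
  open ℚᵘP.≃-Reasoning
  eq : (pos a ℤ.* pos (suc b)) ℤ.* pos 1 ≡ pos a ℤ.* pos (suc b ℕ.* 1)
  eq = trans (ℤP.*-identityʳ (pos a ℤ.* pos (suc b))) (cong (λ z → pos a ℤ.* pos z) (sym (ℕP.*-identityʳ (suc b))))

module _ (ε : ℚ) (0<ε : 0ℚ < ε) where

  private
    numerator-pos : ∀ ε → 0ℚ < ε → Σ ℕ λ a → Σ ℕ λ b → ε * ℕ→ℚ (suc b) ≡ ℕ→ℚ (suc a) × precision ε ≡ suc (suc b DivMod./ suc a)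
    numerator-pos (mkℚ (pos (suc a)) b c) _ = a , b , ε*denominator (suc a) b c , refl
    numerator-pos (mkℚ (pos zero) b c) 0<ε with ℚ.positive 0<ε
    ... | ()
    numerator-pos (mkℚ (ℤ.-[1+ a ]) b c) 0<ε with ℚ.positive 0<ε
    ... | ()

    a = proj₁ (numerator-pos ε 0<ε)
    b = proj₁ (proj₂ (numerator-pos ε 0<ε))
    ε*b≡a = proj₁ (proj₂ (proj₂ (numerator-pos ε 0<ε)))
    e≡ = proj₂ (proj₂ (proj₂ (numerator-pos ε 0<ε)))
    e = precision ε
    c = suc b DivMod./ suc a

    b-pos : ℚ.Positive (ℕ→ℚ (suc b))
    b-pos = ℚP.normalize-pos (suc b) 1

    ea≡ : ℕ→ℚ e * ε * ℕ→ℚ (suc b) ≡ ℕ→ℚ (suc c ℕ.* suc a)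
    ea≡ = trans (ℚP.*-assoc (ℕ→ℚ e) ε (ℕ→ℚ (suc b))) (trans (cong₂ (λ x y → ℕ→ℚ x * y) e≡ ε*b≡a)
      (sym (ℕ→ℚ-* (suc c) (suc a))))

    b≡ : suc b ≡ suc b DivMod.% suc a ℕ.+ c ℕ.* suc a
    b≡ = DivMod.m≡m%n+[m/n]*n (suc b) (suc a)

  precision-lower : 1ℚ ≤ ℕ→ℚ e * ε
  precision-lower = ℚP.*-cancelʳ-≤-pos (ℕ→ℚ (suc b)) {{b-pos}} (ℚP.≤-trans (ℚP.≤-reflexive (ℚP.*-identityˡ (ℕ→ℚ (suc b))))
    (ℚP.≤-trans (ℕ→ℚ-mono (ℕP.≤-trans (ℕP.≤-reflexive b≡) (ℕP.+-monoˡ-≤ (c ℕ.* suc a) (ℕP.<⇒≤ (DivMod.m%n<n (suc b) (suc a))))))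
      (ℚP.≤-reflexive (sym ea≡))))

  precision-upper : ℕ→ℚ e * ε ≤ 1ℚ + ε
  precision-upper = ℚP.*-cancelʳ-≤-pos (ℕ→ℚ (suc b)) {{b-pos}} (ℚP.≤-trans (ℚP.≤-reflexive ea≡)
    (ℚP.≤-trans (ℕ→ℚ-mono (ℕP.+-monoʳ-≤ (suc a) (ℕP.≤-trans (ℕP.m≤n+m (c ℕ.* suc a) (suc b DivMod.% suc a)) (ℕP.≤-reflexive (sym b≡)))))
      (ℚP.≤-reflexive (trans (ℕ→ℚ-+ (suc a) (suc b)) (trans (cong (_+ ℕ→ℚ (suc b)) (sym ε*b≡a)) (lemma ε (ℕ→ℚ (suc b))))))))
    where
    lemma : ∀ ε b → ε * b + b ≡ (1ℚ + ε) * b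
    lemma = solve-∀ ℚ-ring

private
  -- Shows `δ^4 + δ^3 ≤ δ^2` for `δ` between 0 and `½`: the factor `1 - δ - δ^2` is split into
  -- nonnegative pieces.
  cubic-gap : ∀ δ → δ * δ ≡ δ * δ * δ * δ + δ * δ * δ +
    δ * δ * ((½ - δ) + ((½ - δ) * (½ + δ) + ½ * ½))
  cubic-gap = solve-∀ ℚ-ring

module SmallParameters (x δ M : ℚ) (0≤δ : 0ℚ ≤ δ) (0≤M : 0ℚ ≤ M)
  (xδ≡1 : x * δ ≡ 1ℚ) (x≡200M : x ≡ ℕ→ℚ 200 * M) (400≤x : ℕ→ℚ 400 ≤ x)
  where

  0≤x : 0ℚ ≤ x
  0≤x = ℚP.≤-trans (0≤ℕ→ℚ 400) 400≤x

  400δ≤1 : ℕ→ℚ 400 * δ ≤ 1ℚ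
  400δ≤1 = ℚP.≤-trans (*-monoʳ δ 0≤δ 400≤x) (ℚP.≤-reflexive xδ≡1)

  private
    scale-down : ∀ δ → ℕ→ℚ 400 * δ ≤ 1ℚ → δ ≤ recip 400
    scale-down δ h = ≤-by _ (0≤-* (0≤recip 400) (≤⇒0≤- h)) (lemma δ)
      where
      lemma : ∀ δ → recip 400 ≡ δ + recip 400 * (1ℚ - ℕ→ℚ 400 * δ)
      lemma = solve-∀ ℚ-ring

  δ≤ : δ ≤ recip 400
  δ≤ = scale-down δ 400δ≤1

  δ≤½ : δ ≤ ½
  δ≤½ = ℚP.≤-trans δ≤ (ℚP.≤ᵇ⇒≤ tt)

  δ≤1 : δ ≤ 1ℚ
  δ≤1 = ℚP.≤-trans δ≤½ (ℚP.≤ᵇ⇒≤ tt)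

  Mδ≡ : M * δ ≡ recip 200
  Mδ≡ = trans (lemma M δ) (trans (cong (λ z → recip 200 * (z * δ)) (sym x≡200M))
    (trans (cong (recip 200 *_) xδ≡1) (ℚP.*-identityʳ (recip 200))))
    where
    lemma : ∀ M δ → M * δ ≡ recip 200 * (ℕ→ℚ 200 * M * δ)
    lemma = solve-∀ ℚ-ring

  power-≤1 : ∀ j → δ ^ℚ j ≤ 1ℚ
  power-≤1 zero = ℚP.≤-refl
  power-≤1 (suc j) = ℚP.≤-trans (*-mono 0≤δ 0≤1 δ≤1 (power-≤1 j)) (ℚP.≤-reflexive (ℚP.*-identityˡ 1ℚ))

  power-≤δ : ∀ j .{{_ : ℕ.NonZero j}} → δ ^ℚ j ≤ δ
  power-≤δ (suc j) = ℚP.≤-trans (*-monoˡ δ 0≤δ (power-≤1 j)) (ℚP.≤-reflexive (ℚP.*-identityʳ δ))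

  power-≤δ/2 : ∀ j → δ ^ℚ (suc (suc j)) ≤ δ * ½
  power-≤δ/2 j = *-monoˡ δ 0≤δ (ℚP.≤-trans (power-≤δ (suc j)) δ≤½)

  -- There are `1/δ` rounds, so each may cost a multiple of `δ^2`. With this `η` and samples of size
  -- `x^6`, the sampling term is `δ^4 + δ^3`.
  η M′ : ℚ
  η = δ * δ
  M′ = x * x

  M′η≡1 : M′ * η ≡ 1ℚ
  M′η≡1 = trans (lemma x δ) (trans (cong₂ _*_ xδ≡1 xδ≡1) (ℚP.*-identityˡ 1ℚ))
    where
    lemma : ∀ x δ → (x * x) * (δ * δ) ≡ (x * δ) * (x * δ)
    lemma = solve-∀ ℚ-ring

  error-per-round : η + M′ * ((1ℚ + x) * δ ^ℚ 6) ≤ 2ℚ * (δ * δ)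
  error-per-round = ≤-by _ (0≤-* (0≤-* 0≤δ 0≤δ) (0≤-+ (≤⇒0≤- δ≤½)
      (0≤-+ (0≤-* (≤⇒0≤- δ≤½) (0≤-+ 0≤½ 0≤δ)) (0≤-* 0≤½ 0≤½))))
    (trans (double δ) (trans (cong (δ * δ +_) (cubic-gap δ)) (trans (lemma δ _)
      (cong (λ z → δ * δ + z + _) (sym (trans (expand x δ) (trans
        (cong (λ z → z * z * (δ * δ * δ * δ) + z * z * z * (δ * δ * δ)) xδ≡1) (ones (δ * δ * δ * δ) (δ * δ * δ)))))))))
    where
    double : ∀ δ → 2ℚ * (δ * δ) ≡ δ * δ + δ * δ
    double = solve-∀ ℚ-ring
    lemma : ∀ δ y → δ * δ + (δ * δ * δ * δ + δ * δ * δ + y) ≡ δ * δ + (δ * δ * δ * δ + δ * δ * δ) + y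
    lemma = solve-∀ ℚ-ring
    expand : ∀ x δ → x * x * ((1ℚ + x) * (δ * (δ * (δ * (δ * (δ * (δ * 1ℚ))))))) ≡
      (x * δ) * (x * δ) * (δ * δ * δ * δ) + (x * δ) * (x * δ) * (x * δ) * (δ * δ * δ)
    expand = solve-∀ ℚ-ring
    ones : ∀ a b → 1ℚ * 1ℚ * a + 1ℚ * 1ℚ * 1ℚ * b ≡ a + b
    ones = solve-∀ ℚ-ring

  excess-bound : M * (ℕ→ℚ 11 * δ + x * (η + M′ * ((1ℚ + x) * δ ^ℚ 6))) ≤ ℕ→ℚ 13 * recip 200
  excess-bound = ℚP.≤-trans
    (*-monoˡ M 0≤M (ℚP.+-monoʳ-≤ (ℕ→ℚ 11 * δ) (*-monoˡ x 0≤x error-per-round)))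
    (ℚP.≤-reflexive (trans (regroup M x δ) (trans (cong (λ z → ℕ→ℚ 11 * (M * δ) + 2ℚ * (z * (M * δ))) xδ≡1)
      (trans (cong (λ z → ℕ→ℚ 11 * z + 2ℚ * (1ℚ * z)) Mδ≡) refl))))
    where
    regroup : ∀ M x δ → M * (ℕ→ℚ 11 * δ + x * (2ℚ * (δ * δ))) ≡ ℕ→ℚ 11 * (M * δ) + 2ℚ * ((x * δ) * (M * δ))
    regroup = solve-∀ ℚ-ring

  κ : ℚ
  κ = (M * M) * δ ^ℚ 11

  κ-≥0 : 0ℚ ≤ κ
  κ-≥0 = 0≤-* (0≤-* 0≤M 0≤M) (^ℚ-≥0 0≤δ 11)

  κ≤ : κ ≤ δ ^ℚ 9
  κ≤ = ℚP.≤-trans (ℚP.≤-reflexive (trans (regroup M δ (δ ^ℚ 9)) (cong (λ z → z * z * δ ^ℚ 9) Mδ≡)))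
    (ℚP.≤-trans (*-monoʳ {recip 200 * recip 200} {1ℚ} (δ ^ℚ 9) (^ℚ-≥0 0≤δ 9) (ℚP.≤ᵇ⇒≤ tt)) (ℚP.≤-reflexive (ℚP.*-identityˡ (δ ^ℚ 9))))
    where
    regroup : ∀ M δ y → (M * M) * (δ * (δ * y)) ≡ (M * δ) * (M * δ) * y
    regroup = solve-∀ ℚ-ring

  labels*κ≤δ : (1ℚ + x) * κ ≤ δ
  labels*κ≤δ = ℚP.≤-trans (*-monoˡ (1ℚ + x) (0≤-+ 0≤1 0≤x) κ≤)
    (ℚP.≤-trans (ℚP.≤-reflexive (trans (expand x δ (δ ^ℚ 8)) (cong (λ z → δ ^ℚ 9 + z * δ ^ℚ 8) xδ≡1)))
      (ℚP.≤-trans (ℚP.+-mono-≤ (power-≤δ/2 7) (ℚP.≤-trans (ℚP.≤-reflexive (ℚP.*-identityˡ (δ ^ℚ 8))) (power-≤δ/2 6)))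
        (ℚP.≤-reflexive (halves δ))))
    where
    expand : ∀ x δ y → (1ℚ + x) * (δ * y) ≡ δ * y + (x * δ) * y
    expand = solve-∀ ℚ-ring
    halves : ∀ δ → δ * ½ + δ * ½ ≡ δ
    halves = solve-∀ ℚ-ring

  -- The exponents of the number of hypotheses and of the failure bound agree, so only the base
  -- `(1ℚ + x) * κ` has to be small.
  union-bound : ∀ r .{{_ : ℕ.NonZero r}} → (1ℚ + x) ^ℚ r * κ ^ℚ r ≤ δ
  union-bound r = ℚP.≤-trans (ℚP.≤-reflexive (sym (^ℚ-distrib-* (1ℚ + x) κ r)))
    (ℚP.≤-trans (^ℚ-mono (0≤-* (0≤-+ 0≤1 0≤x) κ-≥0) labels*κ≤δ r) (power-≤δ r))

  -- Each of the `x^7` batches might overestimate `ℓ*`. This condition, more than the union over the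
  -- hypotheses, governs the batch size `x^11`.
  repetitions*κ≤δ : x ^ℚ 6 * x * κ ≤ δ
  repetitions*κ≤δ = ℚP.≤-trans (*-monoˡ (x ^ℚ 6 * x) (0≤-* (^ℚ-≥0 0≤x 6) 0≤x) κ≤)
    (ℚP.≤-trans (ℚP.≤-reflexive (trans (regroup x δ) (trans (cong (λ z → z ^ℚ 7 * δ ^ℚ 2) xδ≡1) (ones (δ ^ℚ 2)))))
      (power-≤δ 2))
    where
    regroup : ∀ x δ → (x * (x * (x * (x * (x * (x * 1ℚ)))))) * x *
      (δ * (δ * (δ * (δ * (δ * (δ * (δ * (δ * (δ * 1ℚ))))))))) ≡
      (x * δ * (x * δ * (x * δ * (x * δ * (x * δ * (x * δ * (x * δ * 1ℚ))))))) * (δ * (δ * 1ℚ))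
    regroup = solve-∀ ℚ-ring
    ones : ∀ y → (1ℚ * (1ℚ * (1ℚ * (1ℚ * (1ℚ * (1ℚ * (1ℚ * 1ℚ))))))) * y ≡ y
    ones = solve-∀ ℚ-ring

  -- Since `δ` is at most `1/400`, the failure bounds add up to at most `13/200 + 2/400`, well below
  -- one third.
  failure-≤ : ∀ {a b c} → a ≤ ℕ→ℚ 13 * recip 200 → b ≤ δ → c ≤ δ → pos 2 / 3 ≤ 1ℚ - ((a + b) + c)
  failure-≤ a≤ b≤ c≤ = ℚP.≤-trans (ℚP.≤ᵇ⇒≤ tt) (ℚP.+-monoʳ-≤ 1ℚ (ℚP.neg-antimono-≤
    (ℚP.+-mono-≤ (ℚP.+-mono-≤ a≤ (ℚP.≤-trans b≤ δ≤)) (ℚP.≤-trans c≤ δ≤))))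

-- The exponent is `7 + 11 + 8`: batches, tests per batch, and `1 + 2 * w^7` queries per test, which
-- is at most `w^8` once `w` is at least 3.
query-count-≤ : ∀ w → 3 ℕ.≤ w →
  pow w 6 ℕ.* w ℕ.* (pow w 11 ℕ.* (1 ℕ.+ (w ℕ.* (pow w 6 ℕ.* 1) ℕ.+ w ℕ.* (pow w 6 ℕ.* 1)))) ℕ.+ 0 ℕ.≤ pow w 26
query-count-≤ w@(suc _) 3≤w = ℕP.≤-trans (ℕP.≤-reflexive (ℕP.+-identityʳ _)) (ℕP.≤-trans
    (ℕP.*-mono-≤ (ℕP.≤-reflexive (trans (ℕP.*-comm (pow w 6) w) (sym (pow-suc w 6)))) (ℕP.*-monoʳ-≤ (pow w 11) per-test))
    (ℕP.≤-reflexive (sym (trans (pow-+ w 7 19) (cong (pow w 7 ℕ.*_) (pow-+ w 11 8))))))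
  where
  y≡ : w ℕ.* (pow w 6 ℕ.* 1) ≡ pow w 7
  y≡ = trans (cong (w ℕ.*_) (ℕP.*-identityʳ (pow w 6))) (sym (pow-suc w 6))
  per-test : 1 ℕ.+ (w ℕ.* (pow w 6 ℕ.* 1) ℕ.+ w ℕ.* (pow w 6 ℕ.* 1)) ℕ.≤ pow w 8
  per-test = ℕP.≤-trans (ℕP.≤-reflexive (cong (λ z → 1 ℕ.+ (z ℕ.+ z)) y≡))
    (ℕP.≤-trans (ℕP.+-mono-≤ (pow>0 w 7) (ℕP.+-monoʳ-≤ (pow w 7) (ℕP.≤-reflexive (sym (ℕP.+-identityʳ (pow w 7))))))
      (ℕP.≤-trans (ℕP.*-monoˡ-≤ (pow w 7) 3≤w) (ℕP.≤-reflexive (sym (pow-suc w 7)))))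

module Parameters (n w′ : ℕ) where

  -- `r` is the number of labels in a hypothesis, as `union-bound` expects. Coins are not counted,
  -- so `N` is chosen crudely to make `suc n * w ≤ 2 ^ N` evident.
  w t r s N : ℕ
  w = suc w′
  t = pow w 6
  r = t ℕ.* w
  s = pow w 11
  N = suc n ℕ.* w

  private
    instance
      t≢0 : ℕ.NonZero t
      t≢0 = pow≢0 w 6
      s≢0 : ℕ.NonZero s
      s≢0 = pow≢0 w 11
      r≢0 : ℕ.NonZero r
      r≢0 = ℕP.m*n≢0 t w

  tree : QTree (suc n)
  tree = Algo.tree n (toℕ ∘ proj₁ (balanced-blocks w′ (suc n))) N w w t r s

  queries-≤ : 3 ℕ.≤ w → queries tree ℕ.≤ pow w 26
  queries-≤ 3≤w = ℕP.≤-trans (Algo.tree-queries n (toℕ ∘ proj₁ (balanced-blocks w′ (suc n))) N w w t r s)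
    (query-count-≤ w 3≤w)

  module _ (e : ℕ) (w≡ : w ≡ 400 ℕ.* e) {{_ : ℕ.NonZero e}}
    (G : AdjMatrix (suc n)) (simple : IsSimpleGraph G) (d : ℕ) (dist : IsDistP3Free G d)
    (ε : ℚ) (1≤eε : 1ℚ ≤ ℕ→ℚ e * ε)
    where

    private
      -- `γ` is at most half of `ε` because `1 ≤ e * ε`, and `M` is its inverse.
      M γ : ℚ
      M = 2ℚ * ℕ→ℚ e
      γ = ½ * recip e
      δ = recip w

      0≤M : 0ℚ ≤ M
      0≤M = 0≤-* 0≤2 (0≤ℕ→ℚ e)

      Mγ≡1 : M * γ ≡ 1ℚ
      Mγ≡1 = trans (lemma (ℕ→ℚ e) (recip e)) (ℕ→ℚ*recip e)
        where
        lemma : ∀ e r → 2ℚ * e * (½ * r) ≡ e * r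
        lemma = solve-∀ ℚ-ring

      w≡200M : ℕ→ℚ w ≡ ℕ→ℚ 200 * M
      w≡200M = trans (cong ℕ→ℚ w≡) (trans (ℕ→ℚ-* 400 e) (lemma (ℕ→ℚ e)))
        where
        lemma : ∀ e → ℕ→ℚ 400 * e ≡ ℕ→ℚ 200 * (2ℚ * e)
        lemma = solve-∀ ℚ-ring

      400≤w : 400 ℕ.≤ w
      400≤w = ℕP.≤-trans (ℕP.m≤m*n 400 e) (ℕP.≤-reflexive (sym w≡))

      module 𝕊 = SmallParameters (ℕ→ℚ w) δ M (0≤recip w) 0≤M (ℕ→ℚ*recip w) w≡200M (ℕ→ℚ-mono 400≤w)

      0≤γ : 0ℚ ≤ γ
      0≤γ = 0≤-* 0≤½ (0≤recip e)

      γ+γ≤ε : γ + γ ≤ ε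
      γ+γ≤ε = ℚP.≤-trans (ℚP.≤-reflexive (lemma (recip e))) (ℚP.≤-trans (*-monoˡ (recip e) (0≤recip e) 1≤eε)
        (ℚP.≤-reflexive (trans (regroup (recip e) (ℕ→ℚ e) ε) (trans (cong (_* ε) (ℕ→ℚ*recip e)) (ℚP.*-identityˡ ε)))))
        where
        lemma : ∀ r → ½ * r + ½ * r ≡ r * 1ℚ
        lemma = solve-∀ ℚ-ring
        regroup : ∀ r e ε → r * (e * ε) ≡ e * r * ε
        regroup = solve-∀ ℚ-ring

      γ≡200δ : γ ≡ ℕ→ℚ 200 * δ
      γ≡200δ = trans (sym (ℚP.*-identityʳ γ)) (trans (cong (γ *_) (sym (ℕ→ℚ*recip w))) (trans (cong (λ z → γ * (z * δ)) w≡200M)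
        (trans (regroup γ M δ) (trans (cong (λ z → ℕ→ℚ 200 * (z * δ)) Mγ≡1) (cong (ℕ→ℚ 200 *_) (ℚP.*-identityˡ δ))))))
        where
        regroup : ∀ γ M δ → γ * (ℕ→ℚ 200 * M * δ) ≡ ℕ→ℚ 200 * (M * γ * δ)
        regroup = solve-∀ ℚ-ring

      2δ≤γ : 2ℚ * δ ≤ γ
      2δ≤γ = ℚP.≤-trans (*-monoʳ {2ℚ} {ℕ→ℚ 200} δ (0≤recip w) (ℚP.≤ᵇ⇒≤ tt)) (ℚP.≤-reflexive (sym γ≡200δ))

      module ℂ = Correctness n w′ N t r s (n≤2^n N) G simple d dist

      κ≡ : (M * M) * recip s ≡ 𝕊.κ
      κ≡ = cong (M * M *_) (recip-pow w 11)

      hypotheses≡ : ℕ→ℚ ((suc w ℕ.^ t) ℕ.^ w) ≡ (1ℚ + ℕ→ℚ w) ^ℚ r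
      hypotheses≡ = trans (cong ℕ→ℚ (ℕP.^-*-assoc (suc w) t w)) (trans (ℕ→ℚ-^ (suc w) r) (cong (_^ℚ r) (ℕ→ℚ-suc w)))

    success-≥ : pos 2 / 3 ≤ successProb tree G (accurate (suc n) d ε)
    success-≥ = ℚP.≤-trans (𝕊.failure-≤
        (ℚP.≤-trans (ℚP.≤-reflexive (cong (λ z → M * (ℕ→ℚ 11 * δ + ℕ→ℚ w * (𝕊.η + 𝕊.M′ * z)))
          (cong₂ _*_ (ℕ→ℚ-suc w) (recip-pow w 6)))) 𝕊.excess-bound)
        (ℚP.≤-trans (ℚP.≤-reflexive (cong₂ (λ q κ → q * κ ^ℚ r) hypotheses≡ κ≡)) (𝕊.union-bound r))
        (ℚP.≤-trans (ℚP.≤-reflexive (cong₂ _*_ (trans (ℕ→ℚ-* t w) (cong (_* ℕ→ℚ w) (ℕ→ℚ-pow w 6))) κ≡)) 𝕊.repetitions*κ≤δ))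
      (ℂ.tree-success-≥ 𝕊.η 𝕊.M′ (0≤-* (0≤recip w) (0≤recip w)) (0≤-* 𝕊.0≤x 𝕊.0≤x) 𝕊.M′η≡1
        M γ ε 0≤M Mγ≡1 0≤γ γ+γ≤ε 2δ≤γ)

-- The algorithm and its guarantees

-- With the factor 400 the threshold `γ` equals `200 * δ`, so an expected excess of `13 * δ`
-- contributes `13/200` to the failure probability.
scale : ℚ → ℕ
scale ε = 400 ℕ.* precision ε

suc-pred-scale : ∀ ε → suc (ℕ.pred (scale ε)) ≡ scale ε
suc-pred-scale ε = ℕP.suc-pred (scale ε) {{ℕP.m*n≢0 400 (precision ε) {{_}} {{precision-nonZero ε}}}}

algorithm : Algorithm
algorithm zero ε = output 0ℚ
algorithm (suc n) ε = Parameters.tree n (ℕ.pred (scale ε))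

scaled-≤ : ∀ j c w q ε → q ℕ.≤ pow w j → 0ℚ ≤ ε → ℕ→ℚ w * ε ≤ ℕ→ℚ c → ℕ→ℚ q * ε ^ℚ j ≤ ℕ→ℚ (pow c j)
scaled-≤ j c w q ε q≤ 0≤ε wε≤c = ℚP.≤-trans (*-monoʳ (ε ^ℚ j) (^ℚ-≥0 0≤ε j) (ℕ→ℚ-mono q≤))
  (ℚP.≤-trans (ℚP.≤-reflexive (trans (cong (_* ε ^ℚ j) (ℕ→ℚ-pow w j)) (sym (^ℚ-distrib-* (ℕ→ℚ w) ε j))))
    (ℚP.≤-trans (^ℚ-mono (0≤-* (0≤ℕ→ℚ w) 0≤ε) wε≤c j) (ℚP.≤-reflexive (sym (ℕ→ℚ-pow c j)))))

algorithm-accurate : IsDistApproxP3Free algorithm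
algorithm-accurate zero G simple d dist ε 0<ε ε<1 =
  subst (λ b → pos 2 / 3 ≤ 𝟙 b) (sym (true! (dist≡0 dist))) (ℚP.≤ᵇ⇒≤ tt)
  where
  dist≡0 : IsDistP3Free G d → 0 ≡ d
  dist≡0 ((_ , _ , _ , e) , _) = e
  true! : ∀ {d} → 0 ≡ d → accurate 0 d ε 0ℚ ≡ true
  true! refl = cong (0ℚ ≤ᵇ_) (ℚP.*-zeroʳ ε)
algorithm-accurate (suc n) G simple d dist ε 0<ε ε<1 =
  Parameters.success-≥ n (ℕ.pred (scale ε)) (precision ε) (suc-pred-scale ε) {{precision-nonZero ε}}
    G simple d dist ε (precision-lower ε 0<ε)

-- The base 800 arises from `w * ε ≤ 400 * (1 + ε)` with `ε` below 1.
algorithm-queries : ∀ n ε → 0ℚ < ε → ε < 1ℚ → ℕ→ℚ (queries (algorithm n ε)) * ε ^ℚ 26 ≤ ℕ→ℚ (pow 800 26)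
algorithm-queries zero ε 0<ε ε<1 = ℚP.≤-trans (ℚP.≤-reflexive (ℚP.*-zeroˡ (ε ^ℚ 26))) (0≤ℕ→ℚ (pow 800 26))
algorithm-queries (suc n) ε 0<ε ε<1 = scaled-≤ 26 800 (suc (ℕ.pred (scale ε))) (queries (algorithm (suc n) ε)) ε
  (Parameters.queries-≤ n (ℕ.pred (scale ε)) (ℕP.≤-trans (ℕP.m≤m+n 3 397)
    (ℕP.≤-trans (ℕP.m≤m*n 400 (precision ε) {{precision-nonZero ε}}) (ℕP.≤-reflexive (sym (suc-pred-scale ε))))))
  (ℚP.<⇒≤ 0<ε)
  (ℚP.≤-trans (ℚP.≤-reflexive (trans (cong (λ z → ℕ→ℚ z * ε) (suc-pred-scale ε))
      (trans (cong (_* ε) (ℕ→ℚ-* 400 (precision ε))) (ℚP.*-assoc (ℕ→ℚ 400) (ℕ→ℚ (precision ε)) ε))))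
    (ℚP.≤-trans (*-monoˡ (ℕ→ℚ 400) (0≤ℕ→ℚ 400) (ℚP.≤-trans (precision-upper ε 0<ε) (ℚP.+-monoʳ-≤ 1ℚ (ℚP.<⇒≤ ε<1))))
      (ℚP.≤ᵇ⇒≤ tt)))

theorem1p3 : Σ Algorithm (λ A → IsDistApproxP3Free A × PolyQueryComplexity A)
theorem1p3 = algorithm , algorithm-accurate , pow 800 26 , 26 , algorithm-queries
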